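{- For every integer $k\geq 2$ we have $\mathrm{ex}(n,C_3,\mathrm{rainbow}\text{ - }C_{2k+1})=O\left(n^{1+1/k}\right)$ as $n\to\infty$; that is, there is a constant $c_k$ depending only on $k$ such that for every $n$, every $n$-vertex graph that admits a proper edge-coloring with no rainbow copy of the cycle $C_{2k+1}$ contains at most $c_k n^{1+1/k}$ triangles.
   Context: $C_m$ denotes the cycle with $m$ edges; $C_3$ is a triangle. A proper edge-coloring assigns colors to edges so that edges sharing a vertex get distinct colors. A copy of a graph in an edge-colored graph is rainbow if all its edges receive distinct colors. For graphs $F,H$, $\mathrm{ex}(n,F,\mathrm{rainbow}\text{ - }H)$ is the maximum number of copies of $F$ in an $n$-vertex graph that has a proper edge-coloring containing no rainbow copy of $H$. -}

module Defs where

open import Data.Nat using (ℕ; zero; suc; _+_; _*_; _^_; _<ᵇ_)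
open import Data.Nat.DivMod using (_mod_)
open import Data.Bool using (Bool; true; false; _∧_; if_then_else_)
open import Data.Fin using (Fin; toℕ)
open import Data.List using (List; map; allFin)
open import Data.Nat.ListAction using (sum)
open import Relation.Binary.PropositionalEquality using (_≡_; _≢_)

record Graph (n : ℕ) : Set where
  field
    adj     : Fin n → Fin n → Bool
    adj-sym : ∀ u v → adj u v ≡ adj v u
    irrefl  : ∀ v → adj v v ≡ false

open Graph public

Edge : ∀ {n} → Graph n → Fin n → Fin n → Set
Edge G u v = adj G u v ≡ true

-- An edge-coloring with colors in ℕ: only its values on edges matter;
-- the colour of an edge does not depend on the orientation.
record ProperEdgeColoring {n : ℕ} (G : Graph n) : Set where
  field
    col     : Fin n → Fin n → ℕ
    col-sym : ∀ u v → Edge G u v → col u v ≡ col v u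
    proper  : ∀ u v w → Edge G u v → Edge G u w → v ≢ w → col u v ≢ col u w

open ProperEdgeColoring public

next : ∀ {m} → Fin (suc m) → Fin (suc m)
next {m} i = suc (toℕ i) mod (suc m)

record RainbowCycle {n : ℕ} (G : Graph n) (c : ProperEdgeColoring G) (m : ℕ) : Set where
  field
    vtx       : Fin (suc m) → Fin n
    vtx-inj   : ∀ i j → vtx i ≡ vtx j → i ≡ j
    edges     : ∀ i → Edge G (vtx i) (vtx (next i))
    rainbow   : ∀ i j → col c (vtx i) (vtx (next i)) ≡ col c (vtx j) (vtx (next j)) → i ≡ j

isTriangle : ∀ {n} → Graph n → Fin n → Fin n → Fin n → Bool
isTriangle G a b c =
  (toℕ a <ᵇ toℕ b) ∧ (toℕ b <ᵇ toℕ c) ∧ adj G a b ∧ adj G b c ∧ adj G a c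

triangles : ∀ {n} → Graph n → ℕ
triangles {n} G =
  sum (map (λ a → sum (map (λ b → sum (map (λ c →
    if isTriangle G a b c then 1 else 0) (allFin n))) (allFin n))) (allFin n))

{-# OPTIONS --safe #-}

-- Call a pair of vertices apexed if it lies in a triangle.  If triangles outnumber apexed pairs by more than 6k, then
-- the link of some vertex v has a subgraph of minimum degree above 6k, in which a rainbow path can be grown greedily
-- and closed up through v.  Choose an apex for every apexed pair, and split vertices and colours in two at random:
-- at least 1/64 of the pairs form a graph F in which no apex is a vertex of F and no colour of a side of a chosen
-- triangle occurs in F.  So a rainbow C_{2k} in F would extend through an apex to a rainbow C_{2k+1}, and it remains
-- to bound the number of edges of a graph without rainbow C_{2k}.
--
-- Pass to a subgraph of minimum degree above δ, and let B be D^{-1/2} A D^{-1/2}, up to scaling and rounding.  Its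
-- largest eigenvalue is about 1, so tr B^{2k} is at least about 1.  Since there is no rainbow C_{2k}, every closed walk
-- of length 2k repeats a vertex or a colour.  For symmetric X, the function (a, b) ↦ tr (X B^a X B^b) is convex on lines
-- a + b = const by Cauchy–Schwarz, so the total weight of the walks with a repetition at two given places is largest
-- when these places are as close as possible, where it is O(1/δ) tr B^{2k-2}.  Hence tr B^{2k} ≤ ε tr B^{2k-2} with
-- ε = O(1/δ), and as j ↦ tr B^{2j} is log-convex, the same ratio bound holds for all smaller exponents.  This gives
-- 1 ≲ tr B^{2k} ≤ ε^k tr B^0 = ε^k n, that is, δ = O(n^{1/k}).
module Submission where

open import Defs
open import Algebra.Bundles using (Monoid)
import Algebra.Properties.Semiring.Sum as SemiringSum
import Algebra.Solver.Monoid as MonoidSolver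
import Data.Bool as Bool
open import Data.Bool using (Bool; true; false; if_then_else_; _∧_)
open import Data.Bool.Properties using (T-≡)
open import Data.Empty using (⊥)
open import Data.Fin using (Fin; zero; suc; toℕ; fromℕ; fromℕ<; inject₁)
import Data.Fin.Properties as Fin
open import Data.Fin.Relation.Unary.Top using (view; ‵fromℕ; ‵inject₁)
open import Data.List using (List; []; _∷_; length; map; filter; allFin; cartesianProduct; _++_)
import Data.List.Membership.DecPropositional as DecMembership
open import Data.List.Membership.Propositional using (_∈_; _∉_; find)
open import Data.List.Membership.Propositional.Properties using (∈-filter⁺; ∈-filter⁻; ∈-map⁻; ∈-cartesianProduct⁺; ∈-allFin)
open import Data.List.Properties using (filter-all; filter-notAll; filter-++; length-map; length-tabulate; length-++)
open import Data.List.Relation.Unary.All as All using (All; []; _∷_)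
open import Data.List.Relation.Unary.AllPairs using ([]; _∷_)
open import Data.List.Relation.Unary.Any as Any using (here; there)
open import Data.List.Relation.Unary.Unique.Propositional using (Unique)
open import Data.List.Relation.Unary.Unique.Propositional.Properties using (filter⁺; map⁺; cartesianProduct⁺; allFin⁺)
open import Data.Nat using (ℕ; zero; suc; _+_; _*_; _∸_; _^_; _/_; _%_; _!; _≤_; _<_; _<ᵇ_; z≤n; s≤s; z<s; NonZero; >-nonZero; ≢-nonZero⁻¹)
open import Data.Nat.Divisibility using (divides; ∣-trans; m≤n⇒m!∣n!; m∣m*n)
open import Data.Nat.DivMod using (m/n*n≤m; /-mono-≤; m*n/n≡m; m%n<n; m≡m%n+[m/n]*n; n%n≡0; m<n⇒m%n≡m)
open import Data.Nat.ListAction using (sum)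
open import Data.Nat.Properties
open import Data.Nat.Tactic.RingSolver using (solve-∀)
open import Data.Product using (Σ; _×_; _,_; proj₁; proj₂; ∃)
open import Data.Product.Properties using (≡-dec)
open import Data.Sum using (_⊎_; inj₁; inj₂) renaming (swap to ⊎-swap)
open import Data.Vec as Vec using (Vec; []; _∷_; lookup; _∷ʳ_; _[_]≔_)
import Data.Vec.Properties as VecProperties
open import Data.Vec.Relation.Unary.All as VecAll using ([]; _∷_)
open import Data.Vec.Relation.Unary.All.Properties using (lookup⁺)
open import Data.Vec.Relation.Unary.AllPairs using ([]; _∷_)
open import Data.Vec.Relation.Unary.Unique.Propositional using () renaming (Unique to UniqueVec)
import Data.Vec.Relation.Unary.Unique.Propositional.Properties as UniqueVec
open import Function using (_∘_; id)
open import Function.Bundles using (Equivalence; mk⇔)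
open import Relation.Binary.Definitions using (DecidableEquality)
open import Relation.Binary.PropositionalEquality
open import Relation.Nullary using (¬_; Dec; yes; no; does; contradiction; ¬?; _⊎-dec_; _×-dec_)
open import Relation.Nullary.Decidable using (dec-true; dec-false; does-⇔)
open import Relation.Unary using (Decidable)

-- Finite sums of natural numbers and indicators

module Sum = SemiringSum +-*-semiring

-- Opaque, so that unification sees the summand.
opaque
  ∑ : ∀ {n} → (Fin n → ℕ) → ℕ
  ∑ = Sum.sum

  ∑-suc : ∀ {n} (f : Fin (suc n) → ℕ) → ∑ f ≡ f zero + ∑ (f ∘ suc)
  ∑-suc f = refl

  ∑-cong : ∀ {n} {f g : Fin n → ℕ} → (∀ i → f i ≡ g i) → ∑ f ≡ ∑ g
  ∑-cong = Sum.sum-cong-≗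

  ∑-comm : ∀ {m n} (f : Fin m → Fin n → ℕ) → ∑ (λ i → ∑ (f i)) ≡ ∑ (λ j → ∑ (λ i → f i j))
  ∑-comm = Sum.∑-comm

  ∑-+ : ∀ {n} (f g : Fin n → ℕ) → ∑ (λ i → f i + g i) ≡ ∑ f + ∑ g
  ∑-+ = Sum.∑-distrib-+

  *-∑ : ∀ {n} c (f : Fin n → ℕ) → c * ∑ f ≡ ∑ (λ i → c * f i)
  *-∑ = Sum.*-distribˡ-sum

  ∑-* : ∀ {n} c (f : Fin n → ℕ) → ∑ f * c ≡ ∑ (λ i → f i * c)
  ∑-* = Sum.*-distribʳ-sum

  ∑-mono : ∀ {n} {f g : Fin n → ℕ} → (∀ i → f i ≤ g i) → ∑ f ≤ ∑ g
  ∑-mono {zero}  f≤g = z≤n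
  ∑-mono {suc n} f≤g = +-mono-≤ (f≤g zero) (∑-mono (f≤g ∘ suc))

  ∑-const : ∀ n c → ∑ {n} (λ _ → c) ≡ n * c
  ∑-const zero    c = refl
  ∑-const (suc n) c = cong (c +_) (∑-const n c)

  term≤∑ : ∀ {n} (f : Fin n → ℕ) i → f i ≤ ∑ f
  term≤∑ f zero    = m≤m+n _ _
  term≤∑ f (suc i) = ≤-trans (term≤∑ (f ∘ suc) i) (m≤n+m _ (f zero))

∑-zero : ∀ {n} {f : Fin n → ℕ} → (∀ i → f i ≡ 0) → ∑ f ≡ 0
∑-zero {n} f≡0 = trans (∑-cong f≡0) (trans (∑-const n 0) (*-zeroʳ n))

⟦_⟧ : ∀ {p} {P : Set p} → Dec P → ℕ
⟦ P? ⟧ = if does P? then 1 else 0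

∑-δ : ∀ {n} (f : Fin n → ℕ) x → ∑ (λ z → ⟦ x Fin.≟ z ⟧ * f z) ≡ f x
∑-δ {suc n} f zero    = trans (∑-suc _) (trans (cong₂ _+_ (*-identityˡ (f zero)) (∑-zero λ _ → refl)) (+-identityʳ _))
∑-δ {suc n} f (suc x) = trans (∑-suc _) (trans (∑-cong λ z → cong (_* f (suc z)) (lem z)) (∑-δ (f ∘ suc) x))
  where
  lem : ∀ z → ⟦ suc x Fin.≟ suc z ⟧ ≡ ⟦ x Fin.≟ z ⟧
  lem z with x Fin.≟ z
  ... | yes _ = refl
  ... | no  _ = refl

δ-sym : ∀ {n} (x y : Fin n) → ⟦ x Fin.≟ y ⟧ ≡ ⟦ y Fin.≟ x ⟧
δ-sym x y with x Fin.≟ y | y Fin.≟ x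
... | yes _ | yes _ = refl
... | no  _ | no  _ = refl
... | yes p | no ¬q = contradiction (sym p) ¬q
... | no ¬p | yes q = contradiction (sym q) ¬p

δ-refl : ∀ {n} (x : Fin n) → ⟦ x Fin.≟ x ⟧ ≡ 1
δ-refl x with x Fin.≟ x
... | yes _ = refl
... | no ¬p = contradiction refl ¬p

δ*≤ : ∀ {n} (x y : Fin n) c → ⟦ x Fin.≟ y ⟧ * c ≤ c
δ*≤ x y c with x Fin.≟ y
... | yes _ = ≤-reflexive (+-identityʳ c)
... | no  _ = z≤n

-- Matrices over the natural numbers, powers and traces

Mat : ℕ → Set
Mat n = Fin n → Fin n → ℕ

infix 4 _≐_
infixr 7 _·_
infixr 8 _^^_

_≐_ : ∀ {n} → Mat n → Mat n → Set
A ≐ B = ∀ x y → A x y ≡ B x y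

_·_ : ∀ {n} → Mat n → Mat n → Mat n
(A · B) x y = ∑ λ z → A x z * B z y

𝟙 : ∀ {n} → Mat n
𝟙 x y = ⟦ x Fin.≟ y ⟧

_^^_ : ∀ {n} → Mat n → ℕ → Mat n
A ^^ zero  = 𝟙
A ^^ suc k = A · A ^^ k

tr : ∀ {n} → Mat n → ℕ
tr A = ∑ λ x → A x x

_ᵀ : ∀ {n} → Mat n → Mat n
(A ᵀ) x y = A y x

Sym : ∀ {n} → Mat n → Set
Sym A = A ᵀ ≐ A

·-cong : ∀ {n} {A A′ B B′ : Mat n} → A ≐ A′ → B ≐ B′ → A · B ≐ A′ · B′
·-cong p q x y = ∑-cong λ z → cong₂ _*_ (p x z) (q z y)

·-assoc : ∀ {n} (A B C : Mat n) → (A · B) · C ≐ A · (B · C)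
·-assoc A B C x y = begin
  ∑ (λ z → ∑ (λ w → A x w * B w z) * C z y)   ≡⟨ ∑-cong (λ z → ∑-* (C z y) _) ⟩
  ∑ (λ z → ∑ (λ w → A x w * B w z * C z y))   ≡⟨ ∑-comm (λ z w → A x w * B w z * C z y) ⟩
  ∑ (λ w → ∑ (λ z → A x w * B w z * C z y))   ≡⟨ ∑-cong (λ w → ∑-cong λ z → *-assoc (A x w) _ _) ⟩
  ∑ (λ w → ∑ (λ z → A x w * (B w z * C z y))) ≡⟨ ∑-cong (λ w → *-∑ (A x w) _) ⟨
  ∑ (λ w → A x w * ∑ (λ z → B w z * C z y))   ∎
  where open ≡-Reasoning

·-identityˡ : ∀ {n} (A : Mat n) → 𝟙 · A ≐ A
·-identityˡ A x y = ∑-δ (λ z → A z y) x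

·-identityʳ : ∀ {n} (A : Mat n) → A · 𝟙 ≐ A
·-identityʳ A x y = trans
  (∑-cong λ z → trans (*-comm (A x z) _) (cong (_* A x z) (δ-sym z y)))
  (∑-δ (A x) y)

matMonoid : ℕ → Monoid _ _
matMonoid n = record
  { Carrier = Mat n ; _≈_ = _≐_ ; _∙_ = _·_ ; ε = 𝟙
  ; isMonoid = record
    { isSemigroup = record
      { isMagma = record
        { isEquivalence = record
          { refl = λ _ _ → refl ; sym = λ p x y → sym (p x y) ; trans = λ p q x y → trans (p x y) (q x y) }
        ; ∙-cong = ·-cong }
      ; assoc = ·-assoc }
    ; identity = ·-identityˡ , ·-identityʳ } }

module _ {n : ℕ} where
  open Monoid (matMonoid n) public using () renaming (refl to ≐-refl; sym to ≐-sym; trans to ≐-trans)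

·-congˡ : ∀ {n} {A B B′ : Mat n} → B ≐ B′ → A · B ≐ A · B′
·-congˡ {A = A} = ·-cong (≐-refl {x = A})

·-congʳ : ∀ {n} {A A′ B : Mat n} → A ≐ A′ → A · B ≐ A′ · B
·-congʳ {B = B} p = ·-cong p (≐-refl {x = B})

^^-+ : ∀ {n} (A : Mat n) a b → A ^^ (a + b) ≐ A ^^ a · A ^^ b
^^-+ A zero    b = ≐-sym (·-identityˡ _)
^^-+ A (suc a) b = ≐-trans (·-congˡ {A = A} (^^-+ A a b)) (≐-sym (·-assoc A _ _))

^^-1 : ∀ {n} (A : Mat n) → A ^^ 1 ≐ A
^^-1 = ·-identityʳ

tr-cong : ∀ {n} {A B : Mat n} → A ≐ B → tr A ≡ tr B
tr-cong p = ∑-cong λ x → p x x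

tr-comm : ∀ {n} (A B : Mat n) → tr (A · B) ≡ tr (B · A)
tr-comm A B = trans (∑-comm λ x y → A x y * B y x)
  (∑-cong λ y → ∑-cong λ x → *-comm (A x y) (B y x))

tr-𝟙 : ∀ n → tr (𝟙 {n}) ≡ n
tr-𝟙 n = trans (∑-cong δ-refl) (trans (∑-const n 1) (*-identityʳ n))

ᵀ-· : ∀ {n} (A B : Mat n) → (A · B) ᵀ ≐ B ᵀ · A ᵀ
ᵀ-· A B x y = ∑-cong λ z → *-comm (A y z) (B z x)

^^-comm : ∀ {n} (A : Mat n) k → A ^^ k · A ≐ A · A ^^ k
^^-comm A k = ≐-trans (·-congˡ {A = A ^^ k} (≐-sym (^^-1 A)))
  (≐-trans (≐-sym (^^-+ A k 1)) (λ x y → cong (λ j → (A ^^ j) x y) (+-comm k 1)))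

^^-sym : ∀ {n} {A : Mat n} → Sym A → ∀ k → Sym (A ^^ k)
^^-sym sA zero    x y = δ-sym y x
^^-sym {A = A} sA (suc k) = ≐-trans (ᵀ-· A (A ^^ k))
  (≐-trans (·-cong (^^-sym sA k) sA) (^^-comm A k))

-- Cauchy-Schwarz and convexity of traces

2xy≤x²+y² : ∀ x y → 2 * (x * y) ≤ x * x + y * y
2xy≤x²+y² x y with ≤-total x y
... | inj₁ p with d , refl ← m≤n⇒∃[o]m+o≡n p = begin
  2 * (x * (x + d))                 ≤⟨ m≤m+n _ (d * d) ⟩
  2 * (x * (x + d)) + d * d         ≡⟨ solve-∀′ x d ⟩
  x * x + (x + d) * (x + d)         ∎
  where
  open ≤-Reasoning
  solve-∀′ : ∀ x d → 2 * (x * (x + d)) + d * d ≡ x * x + (x + d) * (x + d)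
  solve-∀′ = solve-∀
... | inj₂ p with d , refl ← m≤n⇒∃[o]m+o≡n p = begin
  2 * ((y + d) * y)                 ≤⟨ m≤m+n _ (d * d) ⟩
  2 * ((y + d) * y) + d * d         ≡⟨ solve-∀′ y d ⟩
  (y + d) * (y + d) + y * y         ∎
  where
  open ≤-Reasoning
  solve-∀′ : ∀ y d → 2 * ((y + d) * y) + d * d ≡ (y + d) * (y + d) + y * y
  solve-∀′ = solve-∀

-- The inner product is ⟨Y, Z⟩ = tr (Yᵀ Z).
tr-AM-GM : ∀ {n} (Y Z : Mat n) α β →
  2 * (α * β * tr (Y ᵀ · Z)) ≤ α * α * tr (Y ᵀ · Y) + β * β * tr (Z ᵀ · Z)
tr-AM-GM {n} Y Z α β = begin
  2 * (α * β * tr (Y ᵀ · Z))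
    ≡⟨ *-assoc 2 (α * β) (tr (Y ᵀ · Z)) ⟨
  2 * (α * β) * tr (Y ᵀ · Z)
    ≡⟨ scale (2 * (α * β)) Y Z ⟩
  ∑ (λ x → ∑ λ z → 2 * (α * β) * (Y z x * Z z x))
    ≤⟨ ∑-mono (λ x → ∑-mono λ z → termwise (Y z x) (Z z x)) ⟩
  ∑ (λ x → ∑ λ z → α * α * (Y z x * Y z x) + β * β * (Z z x * Z z x))
    ≡⟨ trans (∑-cong λ x → ∑-+ (λ z → α * α * (Y z x * Y z x)) _) (∑-+ (λ x → ∑ λ z → α * α * (Y z x * Y z x)) _) ⟩
  ∑ (λ x → ∑ λ z → α * α * (Y z x * Y z x)) + ∑ (λ x → ∑ λ z → β * β * (Z z x * Z z x))
    ≡⟨ cong₂ _+_ (scale (α * α) Y Y) (scale (β * β) Z Z) ⟨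
  α * α * tr (Y ᵀ · Y) + β * β * tr (Z ᵀ · Z) ∎
  where
  open ≤-Reasoning
  scale : ∀ c (Y Z : Mat n) → c * tr (Y ᵀ · Z) ≡ ∑ λ x → ∑ λ z → c * (Y z x * Z z x)
  scale c Y Z = trans (*-∑ c _) (∑-cong λ x → *-∑ c _)
  rearrangeˡ : ∀ α β y z → 2 * (α * β) * (y * z) ≡ 2 * (α * y * (β * z))
  rearrangeˡ = solve-∀
  rearrangeʳ : ∀ α y → α * y * (α * y) ≡ α * α * (y * y)
  rearrangeʳ = solve-∀
  termwise : ∀ y z → 2 * (α * β) * (y * z) ≤ α * α * (y * y) + β * β * (z * z)
  termwise y z = begin
    2 * (α * β) * (y * z)               ≡⟨ rearrangeˡ α β y z ⟩
    2 * (α * y * (β * z))               ≤⟨ 2xy≤x²+y² (α * y) (β * z) ⟩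
    α * y * (α * y) + β * z * (β * z)   ≡⟨ cong₂ _+_ (rearrangeʳ α y) (rearrangeʳ β z) ⟩
    α * α * (y * y) + β * β * (z * z)   ∎

-- Once a convex sequence rises, it keeps rising up to `m`. So each value is at most its
-- predecessor, where induction applies, or at most `g m`.
convex⇒≤ends : ∀ (g : ℕ → ℕ) m C →
  (∀ j → 2 + j ≤ m → 2 * g (1 + j) ≤ g j + g (2 + j)) →
  g 0 ≤ C → g m ≤ C → ∀ j → j ≤ m → g j ≤ C
convex⇒≤ends g m C conv g0≤C gm≤C = go
  where
  rising : ∀ d j → j + suc d ≡ m → g j ≤ g (suc j) → g (suc j) ≤ g m
  rising zero    j eq up = ≤-reflexive (cong g (trans (sym (trans (+-suc j 0) (cong suc (+-identityʳ j)))) eq))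
  rising (suc d) j eq up = ≤-trans up′ (rising d (suc j) (trans (sym (+-suc j (suc d))) eq) up′)
    where
    j+2≤m : 2 + j ≤ m
    j+2≤m = subst (2 + j ≤_) (trans (sym (trans (+-suc j (suc d)) (cong suc (+-suc j d)))) eq) (s≤s (s≤s (m≤m+n j d)))
    up′ : g (suc j) ≤ g (2 + j)
    up′ = +-cancelˡ-≤ (g (suc j)) _ _ (begin
      g (suc j) + g (suc j)       ≡⟨ cong (g (suc j) +_) (+-identityʳ _) ⟨
      2 * g (suc j)               ≤⟨ conv j j+2≤m ⟩
      g j + g (2 + j)             ≤⟨ +-monoˡ-≤ _ up ⟩
      g (suc j) + g (2 + j)       ∎)
      where open ≤-Reasoning
  go : ∀ j → j ≤ m → g j ≤ C
  go zero    _   = g0≤C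
  go (suc j) j<m with ≤-total (g (suc j)) (g j)
  ... | inj₁ down = ≤-trans down (go j (<⇒≤ j<m))
  ... | inj₂ up with d , refl ← m≤n⇒∃[o]m+o≡n j<m = ≤-trans (rising d j (+-suc j d) up) gm≤C

half : ∀ a → ∃ λ p → a ≡ p + p ⊎ a ≡ p + suc p
half zero = 0 , inj₁ refl
half (suc a) with half a
... | p , inj₁ refl = p , inj₂ (sym (+-suc p p))
... | p , inj₂ refl = suc p , inj₁ refl

n+n-injective : ∀ {m n} → m + m ≡ n + n → m ≡ n
n+n-injective {m} {n} eq = *-cancelˡ-≡ m n 2 (begin
  2 * m  ≡⟨ cong (m +_) (+-identityʳ m) ⟩
  m + m  ≡⟨ eq ⟩
  n + n  ≡⟨ cong (n +_) (+-identityʳ n) ⟨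
  2 * n  ∎)
  where open ≡-Reasoning

-- Since `a + b` is even, `a` and `b` have the same parity. Even points form a convex sequence with
-- the given ends; an odd point is the midpoint of two even ones.
line-convex⇒≤ends : ∀ (G : ℕ → ℕ → ℕ) m C →
  (∀ p p′ q q′ → 2 * G (p + p′) (q + q′) ≤ G (p + p) (q + q) + G (p′ + p′) (q′ + q′)) →
  G 0 (m + m) ≤ C → G (m + m) 0 ≤ C →
  ∀ a b → a + b ≡ m + m → G a b ≤ C
line-convex⇒≤ends G m C conv G0≤C Gm≤C a b eq = go (half a) (half b)
  where
  conv′ : ∀ j → 2 + j ≤ m → 2 * G (suc j + suc j) ((m ∸ suc j) + (m ∸ suc j)) ≤
    G (j + j) ((m ∸ j) + (m ∸ j)) + G (2 + j + (2 + j)) ((m ∸ (2 + j)) + (m ∸ (2 + j)))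
  -- Writing `m` as `2 + j + e` eliminates all truncated subtractions.
  conv′ j 2+j≤m with e , refl ← m≤n⇒∃[o]m+o≡n 2+j≤m
    rewrite m+n∸m≡n j e
          | trans (cong (_∸ j) (sym (+-suc j e))) (m+n∸m≡n j (suc e))
          | trans (cong (_∸ j) (trans (cong suc (sym (+-suc j e))) (sym (+-suc j (suc e))))) (m+n∸m≡n j (2 + e))
          | sym (+-suc j (suc j)) | +-suc e e =
    conv j (2 + j) (2 + e) e
  even : ∀ p q → p + q ≡ m → G (p + p) (q + q) ≤ C
  even p q refl = subst (λ r → G (p + p) (r + r) ≤ C) (m+n∸m≡n p q)
    (convex⇒≤ends (λ j → G (j + j) ((m ∸ j) + (m ∸ j))) m C conv′ G0≤C
      (subst (λ r → G (m + m) (r + r) ≤ C) (sym (n∸n≡0 m)) Gm≤C) p (m≤m+n p q))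
  double-+ : ∀ p q → p + p + (q + q) ≡ p + q + (p + q)
  double-+ = solve-∀
  double-suc-+ : ∀ p q → p + suc p + (q + suc q) ≡ p + suc q + (p + suc q)
  double-suc-+ = solve-∀
  parity : ∀ p q → p + p + (q + suc q) ≢ m + m
  parity p q eq = even≢odd m (p + q) (trans (doubleˡ m) (trans (sym eq) (doubleʳ p q)))
    where
    doubleˡ : ∀ m → 2 * m ≡ m + m
    doubleˡ = solve-∀
    doubleʳ : ∀ p q → p + p + (q + suc q) ≡ suc (2 * (p + q))
    doubleʳ = solve-∀
  go : (∃ λ p → a ≡ p + p ⊎ a ≡ p + suc p) → (∃ λ q → b ≡ q + q ⊎ b ≡ q + suc q) → G a b ≤ C
  go (p , inj₁ refl) (q , inj₁ refl) = even p q (n+n-injective (trans (sym (double-+ p q)) eq))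
  go (p , inj₁ refl) (q , inj₂ refl) = contradiction eq (parity p q)
  go (p , inj₂ refl) (q , inj₁ refl) = contradiction (trans (+-comm (q + q) _) eq) (parity q p)
  go (p , inj₂ refl) (q , inj₂ refl) = *-cancelˡ-≤ 2 (begin
    2 * G (p + suc p) (q + suc q)                           ≡⟨ cong (λ r → 2 * G (p + suc p) r) (+-suc q q) ⟩
    2 * G (p + suc p) (suc q + q)                           ≤⟨ conv p (suc p) (suc q) q ⟩
    G (p + p) (suc q + suc q) + G (suc p + suc p) (q + q)   ≤⟨ +-mono-≤ (even p (suc q) p+q+1≡m) (even (suc p) q (trans (sym (+-suc p q)) p+q+1≡m)) ⟩
    C + C                                                   ≡⟨ cong (C +_) (+-identityʳ C) ⟨
    2 * C                                                   ∎)
    where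
    open ≤-Reasoning
    p+q+1≡m : p + suc q ≡ m
    p+q+1≡m = n+n-injective (trans (sym (double-suc-+ p q)) eq)

module _ {n : ℕ} {B X : Mat n} (sB : Sym B) (sX : Sym X) where
  open MonoidSolver (matMonoid n) using (solve; _⊜_; _⊕_)
  private
    Y : ℕ → ℕ → Mat n
    Y p q = B ^^ p · X · B ^^ q

    Yᵀ : ∀ p q → Y p q ᵀ ≐ (B ^^ q · X) · B ^^ p
    Yᵀ p q = ≐-trans (ᵀ-· (B ^^ p) (X · B ^^ q))
      (·-cong (≐-trans (ᵀ-· X (B ^^ q)) (·-cong (^^-sym sB q) sX)) (^^-sym sB p))

    -- Cyclicity of the trace brings the outer powers of `B` together.
    inner : ∀ p p′ q q′ → tr (Y p q ᵀ · Y p′ q′) ≡ tr (X · B ^^ (p + p′) · X · B ^^ (q + q′))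
    inner p p′ q q′ = begin
      tr (Y p q ᵀ · Y p′ q′)
        ≡⟨ tr-cong (·-congʳ {B = Y p′ q′} (Yᵀ p q)) ⟩
      tr (((B ^^ q · X) · B ^^ p) · Y p′ q′)
        ≡⟨ tr-cong (solve 5 (λ q x p p′ q′ → ((q ⊕ x) ⊕ p) ⊕ (p′ ⊕ (x ⊕ q′)) ⊜ q ⊕ (x ⊕ ((p ⊕ p′) ⊕ (x ⊕ q′))))
             (λ _ _ → refl) (B ^^ q) X (B ^^ p) (B ^^ p′) (B ^^ q′)) ⟩
      tr (B ^^ q · (X · (B ^^ p · B ^^ p′) · X · B ^^ q′))
        ≡⟨ tr-comm (B ^^ q) _ ⟩
      tr ((X · (B ^^ p · B ^^ p′) · X · B ^^ q′) · B ^^ q)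
        ≡⟨ tr-cong (solve 5 (λ x p p′ q q′ → (x ⊕ ((p ⊕ p′) ⊕ (x ⊕ q′))) ⊕ q ⊜ x ⊕ ((p ⊕ p′) ⊕ (x ⊕ (q′ ⊕ q))))
             (λ _ _ → refl) X (B ^^ p) (B ^^ p′) (B ^^ q) (B ^^ q′)) ⟩
      tr (X · (B ^^ p · B ^^ p′) · X · (B ^^ q′ · B ^^ q))
        ≡⟨ tr-cong (·-congˡ {A = X} (·-cong (≐-sym (^^-+ B p p′)) (·-congˡ {A = X}
             (≐-trans (≐-sym (^^-+ B q′ q)) (λ x y → cong (λ j → (B ^^ j) x y) (+-comm q′ q)))))) ⟩
      tr (X · B ^^ (p + p′) · X · B ^^ (q + q′)) ∎
      where open ≡-Reasoning

  -- A Cauchy–Schwarz inequality for ⟨BᵖXB^q, B^p′XB^q′⟩.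
  tr-XBXB-convex : ∀ p p′ q q′ → 2 * tr (X · B ^^ (p + p′) · X · B ^^ (q + q′)) ≤
    tr (X · B ^^ (p + p) · X · B ^^ (q + q)) + tr (X · B ^^ (p′ + p′) · X · B ^^ (q′ + q′))
  tr-XBXB-convex p p′ q q′ = begin
    2 * tr (X · B ^^ (p + p′) · X · B ^^ (q + q′))
      ≡⟨ cong (2 *_) (trans (+-identityʳ _) (inner p p′ q q′)) ⟨
    2 * (1 * 1 * tr (Y p q ᵀ · Y p′ q′))
      ≤⟨ tr-AM-GM (Y p q) (Y p′ q′) 1 1 ⟩
    1 * 1 * tr (Y p q ᵀ · Y p q) + 1 * 1 * tr (Y p′ q′ ᵀ · Y p′ q′)
      ≡⟨ cong₂ _+_ (trans (+-identityʳ _) (inner p p q q)) (trans (+-identityʳ _) (inner p′ p′ q′ q′)) ⟩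
    tr (X · B ^^ (p + p) · X · B ^^ (q + q)) + tr (X · B ^^ (p′ + p′) · X · B ^^ (q′ + q′)) ∎
    where open ≤-Reasoning

module _ {n : ℕ} {B : Mat n} (sB : Sym B) where

  tr-ᵀ^^ : ∀ a b → tr ((B ^^ a) ᵀ · B ^^ b) ≡ tr (B ^^ (a + b))
  tr-ᵀ^^ a b = tr-cong (≐-trans (·-congʳ {B = B ^^ b} (^^-sym sB a)) (≐-sym (^^-+ B a b)))

  private
    t : ℕ → ℕ
    t j = tr (B ^^ (j + j))

  -- From 2Eδ t(1+i) ≤ E² t(i) + δ² t(2+i).
  descent-step : ∀ δ E .{{_ : NonZero E}} i →
    δ * t (2 + i) ≤ E * t (1 + i) → δ * t (1 + i) ≤ E * t i
  descent-step δ E i hyp = *-cancelˡ-≤ E (+-cancelʳ-≤ (E * (δ * t (1 + i))) _ _ (begin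
    E * (δ * t (1 + i)) + E * (δ * t (1 + i))    ≡⟨ twice E δ (t (1 + i)) ⟩
    2 * (E * δ * tr (B ^^ (1 + i + (1 + i))))    ≡⟨ cong (λ j → 2 * (E * δ * tr (B ^^ j))) (sym (+-suc i (suc i))) ⟩
    2 * (E * δ * tr (B ^^ (i + (2 + i))))        ≡⟨ cong (λ s → 2 * (E * δ * s)) (tr-ᵀ^^ i (2 + i)) ⟨
    2 * (E * δ * tr ((B ^^ i) ᵀ · B ^^ (2 + i))) ≤⟨ tr-AM-GM (B ^^ i) (B ^^ (2 + i)) E δ ⟩
    E * E * tr ((B ^^ i) ᵀ · B ^^ i) + δ * δ * tr ((B ^^ (2 + i)) ᵀ · B ^^ (2 + i))
      ≡⟨ cong₂ (λ r s → E * E * r + δ * δ * s) (tr-ᵀ^^ i i) (tr-ᵀ^^ (2 + i) (2 + i)) ⟩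
    E * E * t i + δ * δ * t (2 + i)              ≡⟨ cong₂ _+_ (*-assoc E E _) (*-assoc δ δ _) ⟩
    E * (E * t i) + δ * (δ * t (2 + i))          ≤⟨ +-monoʳ-≤ (E * (E * t i)) (*-monoʳ-≤ δ hyp) ⟩
    E * (E * t i) + δ * (E * t (1 + i))          ≡⟨ cong (E * (E * t i) +_) (swap δ E _) ⟩
    E * (E * t i) + E * (δ * t (1 + i))          ∎))
    where
    open ≤-Reasoning
    twice : ∀ E δ s → E * (δ * s) + E * (δ * s) ≡ 2 * (E * δ * s)
    twice = solve-∀
    swap : ∀ δ E s → δ * (E * s) ≡ E * (δ * s)
    swap = solve-∀

  -- `descent-step` carries the ratio bound at `k` down to every smaller exponent, and the product
  -- of these bounds telescopes down to `tr 𝟙`, which is `n`.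
  descent : ∀ δ E .{{_ : NonZero E}} k → δ * t (suc k) ≤ E * t k → δ ^ suc k * t (suc k) ≤ E ^ suc k * n
  descent δ E zero    hyp = subst₂ _≤_ (cong (_* t 1) (sym (*-identityʳ δ)))
    (cong₂ _*_ (sym (*-identityʳ E)) (tr-𝟙 n)) hyp
  descent δ E (suc k) hyp = begin
    δ ^ suc (suc k) * t (2 + k)           ≡⟨ assocˡ δ (δ ^ suc k) _ ⟩
    δ ^ suc k * (δ * t (2 + k))           ≤⟨ *-monoʳ-≤ (δ ^ suc k) hyp ⟩
    δ ^ suc k * (E * t (1 + k))           ≡⟨ swap (δ ^ suc k) E _ ⟩
    E * (δ ^ suc k * t (1 + k))           ≤⟨ *-monoʳ-≤ E (descent δ E k (descent-step δ E k hyp)) ⟩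
    E * (E ^ suc k * n)                   ≡⟨ *-assoc E (E ^ suc k) n ⟨
    E ^ suc (suc k) * n                   ∎
    where
    open ≤-Reasoning
    assocˡ : ∀ δ d s → δ * d * s ≡ d * (δ * s)
    assocˡ = solve-∀
    swap : ∀ δ E s → δ * (E * s) ≡ E * (δ * s)
    swap = solve-∀

  module _ (N : ℕ) (u : Fin n → ℕ) (N*u≤Bu : ∀ x → N * u x ≤ ∑ λ y → B x y * u y) where
    private
      S : ℕ
      S = ∑ λ x → u x * u x

      uuᵀ : Mat n
      uuᵀ x y = u x * u y

    -- All entries are nonnegative, so multiplication by `B` preserves the inequality `N u ≤ B u`.
    ^^-supereigenvector : ∀ k x → N ^ k * u x ≤ ∑ λ y → (B ^^ k) x y * u y
    ^^-supereigenvector zero    x = ≤-reflexive (trans (*-identityˡ (u x)) (sym (∑-δ u x)))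
    ^^-supereigenvector (suc k) x = begin
      N * N ^ k * u x                                     ≡⟨ swap N (N ^ k) (u x) ⟩
      N ^ k * (N * u x)                                   ≤⟨ *-monoʳ-≤ (N ^ k) (N*u≤Bu x) ⟩
      N ^ k * ∑ (λ y → B x y * u y)                       ≡⟨ *-∑ (N ^ k) _ ⟩
      ∑ (λ y → N ^ k * (B x y * u y))                     ≡⟨ ∑-cong (λ y → swap′ (N ^ k) (B x y) (u y)) ⟩
      ∑ (λ y → B x y * (N ^ k * u y))                     ≤⟨ ∑-mono (λ y → *-monoʳ-≤ (B x y) (^^-supereigenvector k y)) ⟩
      ∑ (λ y → B x y * ∑ (λ z → (B ^^ k) y z * u z))      ≡⟨ ∑-cong (λ y → *-∑ (B x y) _) ⟩
      ∑ (λ y → ∑ (λ z → B x y * ((B ^^ k) y z * u z)))    ≡⟨ ∑-comm (λ y z → B x y * ((B ^^ k) y z * u z)) ⟩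
      ∑ (λ z → ∑ (λ y → B x y * ((B ^^ k) y z * u z)))    ≡⟨ ∑-cong (λ z → ∑-cong λ y → *-assoc (B x y) _ _) ⟨
      ∑ (λ z → ∑ (λ y → B x y * (B ^^ k) y z * u z))      ≡⟨ ∑-cong (λ z → ∑-* (u z) (λ y → B x y * (B ^^ k) y z)) ⟨
      ∑ (λ z → (B ^^ suc k) x z * u z)                    ∎
      where
      open ≤-Reasoning
      swap : ∀ a b c → a * b * c ≡ b * (a * c)
      swap = solve-∀
      swap′ : ∀ a b c → a * (b * c) ≡ b * (a * c)
      swap′ = solve-∀

    -- The Rayleigh quotient of u bounds the largest eigenvalue of B²ᵏ, hence its trace.
    supereigenvector⇒tr : ∀ k → 0 < S → N ^ (k + k) ≤ t k
    supereigenvector⇒tr k 0<S = *-cancelˡ-≤ (S * S) {{m*n≢0 S S {{>-nonZero 0<S}} {{>-nonZero 0<S}}}}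
      (+-cancelʳ-≤ (N ^ k * N ^ k * (S * S)) _ _ (begin
      S * S * N ^ (k + k) + N ^ k * N ^ k * (S * S)
        ≡⟨ cong (λ z → S * S * z + N ^ k * N ^ k * (S * S)) (^-distribˡ-+-* N k k) ⟩
      S * S * (N ^ k * N ^ k) + N ^ k * N ^ k * (S * S)
        ≡⟨ twice S (N ^ k) ⟩
      2 * (S * N ^ k * (N ^ k * S))
        ≤⟨ *-monoʳ-≤ 2 (*-monoʳ-≤ (S * N ^ k) cross) ⟩
      2 * (S * N ^ k * tr ((B ^^ k) ᵀ · uuᵀ))
        -- The coefficients make the contribution of `uuᵀ` exactly half of the left-hand side, so
        -- that it cancels.
        ≤⟨ tr-AM-GM (B ^^ k) uuᵀ S (N ^ k) ⟩
      S * S * tr ((B ^^ k) ᵀ · B ^^ k) + N ^ k * N ^ k * tr (uuᵀ ᵀ · uuᵀ)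
        ≡⟨ cong₂ (λ a b → S * S * a + N ^ k * N ^ k * b) (tr-ᵀ^^ k k) square ⟩
      S * S * t k + N ^ k * N ^ k * (S * S) ∎))
      where
      open ≤-Reasoning
      twice : ∀ s m → s * s * (m * m) + m * m * (s * s) ≡ 2 * (s * m * (m * s))
      twice = solve-∀
      shuffle : ∀ m a b → m * (a * b) ≡ m * a * b
      shuffle = solve-∀
      shuffle′ : ∀ m a b → m * a * b ≡ m * (a * b)
      shuffle′ = solve-∀
      shuffle″ : ∀ a b → b * a * (b * a) ≡ a * a * (b * b)
      shuffle″ = solve-∀
      cross : N ^ k * S ≤ tr ((B ^^ k) ᵀ · uuᵀ)
      cross = begin
        N ^ k * S                                             ≡⟨ *-∑ (N ^ k) _ ⟩
        ∑ (λ x → N ^ k * (u x * u x))                         ≡⟨ ∑-cong (λ x → shuffle (N ^ k) (u x) (u x)) ⟩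
        ∑ (λ x → N ^ k * u x * u x)                           ≤⟨ ∑-mono (λ x → *-monoˡ-≤ (u x) (^^-supereigenvector k x)) ⟩
        ∑ (λ x → ∑ (λ y → (B ^^ k) x y * u y) * u x)          ≡⟨ ∑-cong (λ x → ∑-* (u x) _) ⟩
        ∑ (λ x → ∑ (λ y → (B ^^ k) x y * u y * u x))          ≡⟨ ∑-cong (λ x → ∑-cong λ y → trans (shuffle′ ((B ^^ k) x y) (u y) (u x)) (cong (_* (u y * u x)) (sym (^^-sym sB k x y)))) ⟩
        ∑ (λ x → ∑ (λ y → (B ^^ k) y x * (u y * u x)))        ∎
      square : tr (uuᵀ ᵀ · uuᵀ) ≡ S * S
      square = begin-equality
        ∑ (λ x → ∑ (λ y → u y * u x * (u y * u x)))           ≡⟨ ∑-cong (λ x → ∑-cong λ y → shuffle″ (u x) (u y)) ⟩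
        ∑ (λ x → ∑ (λ y → u x * u x * (u y * u y)))           ≡⟨ ∑-cong (λ x → *-∑ (u x * u x) _) ⟨
        ∑ (λ x → u x * u x * S)                               ≡⟨ ∑-* S _ ⟨
        S * S                                                 ∎

-- Weighted walks and repetitions along them

∑ᵥ : ∀ {n} m → (Vec (Fin n) m → ℕ) → ℕ
∑ᵥ zero    f = f []
∑ᵥ (suc m) f = ∑ λ y → ∑ᵥ m (f ∘ (y ∷_))

∑ᵥ-cong : ∀ {n} m {f g : Vec (Fin n) m → ℕ} → (∀ ys → f ys ≡ g ys) → ∑ᵥ m f ≡ ∑ᵥ m g
∑ᵥ-cong zero    p = p []
∑ᵥ-cong (suc m) p = ∑-cong λ y → ∑ᵥ-cong m (p ∘ (y ∷_))

∑ᵥ-mono : ∀ {n} m {f g : Vec (Fin n) m → ℕ} → (∀ ys → f ys ≤ g ys) → ∑ᵥ m f ≤ ∑ᵥ m g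
∑ᵥ-mono zero    p = p []
∑ᵥ-mono (suc m) p = ∑-mono λ y → ∑ᵥ-mono m (p ∘ (y ∷_))

∑ᵥ-+ : ∀ {n} m (f g : Vec (Fin n) m → ℕ) → ∑ᵥ m (λ ys → f ys + g ys) ≡ ∑ᵥ m f + ∑ᵥ m g
∑ᵥ-+ zero    f g = refl
∑ᵥ-+ (suc m) f g = trans (∑-cong λ y → ∑ᵥ-+ m (f ∘ (y ∷_)) (g ∘ (y ∷_))) (∑-+ (λ y → ∑ᵥ m (f ∘ (y ∷_))) _)

*-∑ᵥ : ∀ {n} m c (f : Vec (Fin n) m → ℕ) → c * ∑ᵥ m f ≡ ∑ᵥ m (λ ys → c * f ys)
*-∑ᵥ zero    c f = refl
*-∑ᵥ (suc m) c f = trans (*-∑ c _) (∑-cong λ y → *-∑ᵥ m c (f ∘ (y ∷_)))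

-- The walk visits `s`, then `ys`, then `t`. With `f` the adjacency, the colour or the source of a
-- step, the same function yields its edges, its colours or its vertices.
steps : ∀ {V A : Set} {m} → (V → V → A) → V → Vec V m → V → Vec A (suc m)
steps f s []       t = f s t ∷ []
steps f s (y ∷ ys) t = f s y ∷ steps f y ys t

steps-source : ∀ {V : Set} {m} s (ys : Vec V m) t → steps (λ x _ → x) s ys t ≡ s ∷ ys
steps-source s []       t = refl
steps-source s (y ∷ ys) t = cong (s ∷_) (steps-source y ys t)

weight : ∀ {n m} → Mat n → Fin n → Vec (Fin n) m → Fin n → ℕ
weight B s []       t = B s t
weight B s (y ∷ ys) t = B s y * weight B y ys t

occurrences : ∀ {L m} → Fin L → Vec (Fin L) m → ℕ
occurrences c []       = 0
occurrences c (l ∷ ls) = ⟦ c Fin.≟ l ⟧ + occurrences c ls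

-- The number of pairs of positions with equal entries.
repetitions : ∀ {L m} → Vec (Fin L) m → ℕ
repetitions []       = 0
repetitions (l ∷ ls) = occurrences l ls + repetitions ls

occurrences≡0⇒All≢ : ∀ {L m} (c : Fin L) (ls : Vec (Fin L) m) → occurrences c ls ≡ 0 → VecAll.All (c ≢_) ls
occurrences≡0⇒All≢ c []       _ = []
occurrences≡0⇒All≢ c (l ∷ ls) eq with c Fin.≟ l
... | no c≢l = c≢l ∷ occurrences≡0⇒All≢ c ls eq

repetitions≡0⇒Unique : ∀ {L m} (ls : Vec (Fin L) m) → repetitions ls ≡ 0 → UniqueVec ls
repetitions≡0⇒Unique []       _ = []
repetitions≡0⇒Unique (l ∷ ls) eq =
  occurrences≡0⇒All≢ l ls (m+n≡0⇒m≡0 _ eq) ∷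
  repetitions≡0⇒Unique ls (m+n≡0⇒n≡0 (occurrences l ls) eq)

tr-·-+ : ∀ {n} (A P Q : Mat n) → tr (A · λ x y → P x y + Q x y) ≡ tr (A · P) + tr (A · Q)
tr-·-+ A P Q = trans
  (∑-cong λ x → trans (∑-cong λ z → *-distribˡ-+ (A x z) _ _) (∑-+ (λ z → A x z * P z x) _))
  (∑-+ (λ x → ∑ λ z → A x z * P z x) _)

tr-·-∑ : ∀ {n L} (A : Mat n) (P : Fin L → Mat n) →
  tr (A · λ x y → ∑ λ l → P l x y) ≡ ∑ λ l → tr (A · P l)
tr-·-∑ A P = begin
  ∑ (λ x → ∑ λ z → A x z * ∑ λ l → P l z x)     ≡⟨ ∑-cong (λ x → ∑-cong λ z → *-∑ (A x z) _) ⟩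
  ∑ (λ x → ∑ λ z → ∑ λ l → A x z * P l z x)     ≡⟨ ∑-cong (λ x → ∑-comm λ z l → A x z * P l z x) ⟩
  ∑ (λ x → ∑ λ l → ∑ λ z → A x z * P l z x)     ≡⟨ ∑-comm (λ x l → ∑ λ z → A x z * P l z x) ⟩
  ∑ (λ l → ∑ λ x → ∑ λ z → A x z * P l z x)     ∎
  where open ≡-Reasoning

walks : ∀ {n} (B : Mat n) m s t → ∑ᵥ m (λ ys → weight B s ys t) ≡ (B ^^ suc m) s t
walks B zero    s t = sym (^^-1 B s t)
walks B (suc m) s t = ∑-cong λ y → trans (sym (*-∑ᵥ m (B s y) _)) (cong (B s y *_) (walks B m y t))

-- Labels are arbitrary functions of a step, so colours and source vertices are treated alike. `B`
-- is the sum of the matrices `X c`; `Occ c m` and `Rep m` are sums over walks of `suc m` steps.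
module LabelledWalks {n L : ℕ} (B : Mat n) (ℓ : Fin n → Fin n → Fin L) where
  open MonoidSolver (matMonoid n) using (solve; _⊜_; _⊕_)

  X : Fin L → Mat n
  X c x y = ⟦ c Fin.≟ ℓ x y ⟧ * B x y

  Occ : Fin L → ℕ → Mat n
  Occ c m s t = ∑ᵥ m λ ys → weight B s ys t * occurrences c (steps ℓ s ys t)

  Rep : ℕ → Mat n
  Rep m s t = ∑ᵥ m λ ys → weight B s ys t * repetitions (steps ℓ s ys t)

  private
    ∑-sift : ∀ (l : Fin L) (f : Fin L → ℕ) → ∑ (λ c → ⟦ c Fin.≟ l ⟧ * f c) ≡ f l
    ∑-sift l f = trans (∑-cong λ c → cong (_* f c) (δ-sym c l)) (∑-δ f l)

  Occ-zero : ∀ c → Occ c 0 ≐ X c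
  Occ-zero c s t = trans (cong (B s t *_) (+-identityʳ _)) (*-comm (B s t) _)

  -- The step of label `c` is either the first one, followed by an arbitrary walk, or a later one.
  Occ-suc : ∀ c m → Occ c (suc m) ≐ λ s t → (X c · B ^^ suc m) s t + (B · Occ c m) s t
  Occ-suc c m s t = trans (∑-cong split) (∑-+ (λ y → X c s y * (B ^^ suc m) y t) _)
    where
    expand : ∀ b w i o → b * w * (i + o) ≡ i * b * w + b * (w * o)
    expand = solve-∀
    split : ∀ y → ∑ᵥ m (λ ys → B s y * weight B y ys t * (⟦ c Fin.≟ ℓ s y ⟧ + occurrences c (steps ℓ y ys t))) ≡
      X c s y * (B ^^ suc m) y t + B s y * Occ c m y t
    split y = begin
      ∑ᵥ m (λ ys → B s y * weight B y ys t * (⟦ c Fin.≟ ℓ s y ⟧ + occurrences c (steps ℓ y ys t)))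
        ≡⟨ ∑ᵥ-cong m (λ ys → expand (B s y) (weight B y ys t) _ _) ⟩
      ∑ᵥ m (λ ys → X c s y * weight B y ys t + B s y * (weight B y ys t * occurrences c (steps ℓ y ys t)))
        ≡⟨ ∑ᵥ-+ m (λ ys → X c s y * weight B y ys t) _ ⟩
      ∑ᵥ m (λ ys → X c s y * weight B y ys t) + ∑ᵥ m (λ ys → B s y * (weight B y ys t * occurrences c (steps ℓ y ys t)))
        ≡⟨ cong₂ _+_ (*-∑ᵥ m (X c s y) _) (*-∑ᵥ m (B s y) _) ⟨
      X c s y * ∑ᵥ m (λ ys → weight B y ys t) + B s y * Occ c m y t
        ≡⟨ cong (λ w → X c s y * w + B s y * Occ c m y t) (walks B m y t) ⟩
      X c s y * (B ^^ suc m) y t + B s y * Occ c m y t ∎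
      where open ≡-Reasoning

  Rep-zero : ∀ s t → Rep 0 s t ≡ 0
  Rep-zero s t = *-zeroʳ (B s t)

  -- A repeated pair either involves the first step, whose label `c` then occurs again later, or
  -- lies in the rest of the walk.
  Rep-suc : ∀ m → Rep (suc m) ≐ λ s t → ∑ (λ c → (X c · Occ c m) s t) + (B · Rep m) s t
  Rep-suc m s t = trans (∑-cong split)
    (trans (∑-+ (λ y → ∑ λ c → X c s y * Occ c m y t) _)
      (cong (_+ (B · Rep m) s t) (∑-comm λ y c → X c s y * Occ c m y t)))
    where
    expand : ∀ b w i o → b * w * (i + o) ≡ b * (w * i) + b * (w * o)
    expand = solve-∀
    split : ∀ y → ∑ᵥ m (λ ys → B s y * weight B y ys t * (occurrences (ℓ s y) (steps ℓ y ys t) + repetitions (steps ℓ y ys t))) ≡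
      ∑ (λ c → X c s y * Occ c m y t) + B s y * Rep m y t
    split y = begin
      ∑ᵥ m (λ ys → B s y * weight B y ys t * (occurrences (ℓ s y) (steps ℓ y ys t) + repetitions (steps ℓ y ys t)))
        ≡⟨ ∑ᵥ-cong m (λ ys → expand (B s y) (weight B y ys t) _ _) ⟩
      ∑ᵥ m (λ ys → B s y * (weight B y ys t * occurrences (ℓ s y) (steps ℓ y ys t)) + B s y * (weight B y ys t * repetitions (steps ℓ y ys t)))
        ≡⟨ ∑ᵥ-+ m (λ ys → B s y * (weight B y ys t * occurrences (ℓ s y) (steps ℓ y ys t))) _ ⟩
      ∑ᵥ m (λ ys → B s y * (weight B y ys t * occurrences (ℓ s y) (steps ℓ y ys t))) + ∑ᵥ m (λ ys → B s y * (weight B y ys t * repetitions (steps ℓ y ys t)))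
        ≡⟨ cong₂ _+_ (*-∑ᵥ m (B s y) _) (*-∑ᵥ m (B s y) _) ⟨
      B s y * Occ (ℓ s y) m y t + B s y * Rep m y t
        ≡⟨ cong (_+ B s y * Rep m y t) (∑-sift (ℓ s y) (λ c → B s y * Occ c m y t)) ⟨
      ∑ (λ c → ⟦ c Fin.≟ ℓ s y ⟧ * (B s y * Occ c m y t)) + B s y * Rep m y t
        ≡⟨ cong (_+ B s y * Rep m y t) (∑-cong λ c → *-assoc ⟦ c Fin.≟ ℓ s y ⟧ (B s y) (Occ c m y t)) ⟨
      ∑ (λ c → X c s y * Occ c m y t) + B s y * Rep m y t ∎
      where open ≡-Reasoning

  -- `Z c` accumulates what precedes the walk: the induction absorbs the first step into it. The
  -- step of label `c` has `suc r` possible positions, and `hyp` bounds each of them.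
  tr-Occ≤ : ∀ r (Z : Fin L → Mat n) C →
    (∀ a b → a + b ≡ r → ∑ (λ c → tr ((Z c · B ^^ a) · X c · B ^^ b)) ≤ C) →
    ∑ (λ c → tr (Z c · Occ c r)) ≤ suc r * C
  tr-Occ≤ zero Z C hyp = begin
    ∑ (λ c → tr (Z c · Occ c 0))
      ≡⟨ ∑-cong (λ c → tr-cong (·-cong (≐-sym (·-identityʳ (Z c))) (≐-trans (Occ-zero c) (≐-sym (·-identityʳ (X c)))))) ⟩
    ∑ (λ c → tr ((Z c · 𝟙) · X c · 𝟙))
      ≤⟨ hyp 0 0 refl ⟩
    C
      ≡⟨ +-identityʳ C ⟨
    1 * C ∎
    where open ≤-Reasoning
  tr-Occ≤ (suc r) Z C hyp = begin
    ∑ (λ c → tr (Z c · Occ c (suc r)))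
      ≡⟨ ∑-cong (λ c → trans (tr-cong (·-congˡ {A = Z c} (Occ-suc c r))) (tr-·-+ (Z c) (X c · B ^^ suc r) _)) ⟩
    ∑ (λ c → tr (Z c · X c · B ^^ suc r) + tr (Z c · B · Occ c r))
      ≡⟨ ∑-+ (λ c → tr (Z c · X c · B ^^ suc r)) _ ⟩
    ∑ (λ c → tr (Z c · X c · B ^^ suc r)) + ∑ (λ c → tr (Z c · B · Occ c r))
      ≡⟨ cong₂ _+_ (∑-cong λ c → tr-cong (·-congʳ {B = X c · B ^^ suc r} (≐-sym (·-identityʳ (Z c)))))
           (∑-cong λ c → tr-cong (≐-sym (·-assoc (Z c) B (Occ c r)))) ⟩
    ∑ (λ c → tr ((Z c · 𝟙) · X c · B ^^ suc r)) + ∑ (λ c → tr ((Z c · B) · Occ c r))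
      ≤⟨ +-mono-≤ (hyp 0 (suc r) refl) (tr-Occ≤ r (λ c → Z c · B) C λ a b a+b≡r → begin
           ∑ (λ c → tr (((Z c · B) · B ^^ a) · X c · B ^^ b))
             ≡⟨ ∑-cong (λ c → tr-cong (·-congʳ {B = X c · B ^^ b} (·-assoc (Z c) B (B ^^ a)))) ⟩
           ∑ (λ c → tr ((Z c · B ^^ suc a) · X c · B ^^ b))
             ≤⟨ hyp (suc a) b (cong suc a+b≡r) ⟩
           C ∎) ⟩
    suc (suc r) * C ∎
    where open ≤-Reasoning

  -- `i`, `a` and `b` count the steps before, between and after the two equally labelled ones. The
  -- factor `suc r * suc r` is a generous bound for the number of pairs of positions.
  tr-Rep≤ : ∀ r (Z : Mat n) C →
    (∀ i a b → suc (i + a + b) ≡ r → ∑ (λ c → tr ((Z · B ^^ i) · X c · B ^^ a · X c · B ^^ b)) ≤ C) →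
    tr (Z · Rep r) ≤ suc r * suc r * C
  tr-Rep≤ zero Z C hyp = ≤-trans (≤-reflexive (∑-zero λ x → ∑-zero λ z → trans (cong (Z x z *_) (Rep-zero z x)) (*-zeroʳ (Z x z)))) z≤n
  tr-Rep≤ (suc r) Z C hyp = begin
    tr (Z · Rep (suc r))
      ≡⟨ tr-cong (·-congˡ {A = Z} (Rep-suc r)) ⟩
    tr (Z · λ s t → ∑ (λ c → (X c · Occ c r) s t) + (B · Rep r) s t)
      ≡⟨ tr-·-+ Z (λ s t → ∑ (λ c → (X c · Occ c r) s t)) _ ⟩
    tr (Z · λ s t → ∑ (λ c → (X c · Occ c r) s t)) + tr (Z · B · Rep r)
      ≡⟨ cong₂ _+_ (tr-·-∑ Z (λ c → X c · Occ c r)) (tr-cong (≐-sym (·-assoc Z B (Rep r)))) ⟩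
    ∑ (λ c → tr (Z · X c · Occ c r)) + tr ((Z · B) · Rep r)
      ≡⟨ cong (_+ tr ((Z · B) · Rep r)) (∑-cong λ c → tr-cong (≐-sym (·-assoc Z (X c) (Occ c r)))) ⟩
    ∑ (λ c → tr ((Z · X c) · Occ c r)) + tr ((Z · B) · Rep r)
      ≤⟨ +-mono-≤
           (tr-Occ≤ r (λ c → Z · X c) C λ a b a+b≡r → begin
             ∑ (λ c → tr (((Z · X c) · B ^^ a) · X c · B ^^ b))
               ≡⟨ ∑-cong (λ c → tr-cong (≐-trans (solve 4 (λ z x a b → ((z ⊕ x) ⊕ a) ⊕ (x ⊕ b) ⊜ z ⊕ (x ⊕ (a ⊕ (x ⊕ b))))
                    (λ _ _ → refl) Z (X c) (B ^^ a) (B ^^ b)) (·-congʳ {B = X c · B ^^ a · X c · B ^^ b} (≐-sym (·-identityʳ Z))))) ⟩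
             ∑ (λ c → tr ((Z · 𝟙) · X c · B ^^ a · X c · B ^^ b))
               ≤⟨ hyp 0 a b (cong suc a+b≡r) ⟩
             C ∎)
           (tr-Rep≤ r (Z · B) C λ i a b eq → begin
             ∑ (λ c → tr (((Z · B) · B ^^ i) · X c · B ^^ a · X c · B ^^ b))
               ≡⟨ ∑-cong (λ c → tr-cong (·-congʳ {B = X c · B ^^ a · X c · B ^^ b} (·-assoc Z B (B ^^ i)))) ⟩
             ∑ (λ c → tr ((Z · B ^^ suc i) · X c · B ^^ a · X c · B ^^ b))
               ≤⟨ hyp (suc i) a b (cong suc eq) ⟩
             C ∎) ⟩
    suc r * C + suc r * suc r * C
      ≤⟨ m≤m+n _ ((2 + r) * C) ⟩
    suc r * C + suc r * suc r * C + (2 + r) * C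
      ≡⟨ regroup r C ⟩
    suc (suc r) * suc (suc r) * C ∎
    where
    open ≤-Reasoning
    regroup : ∀ r C → suc r * C + suc r * suc r * C + (2 + r) * C ≡ suc (suc r) * suc (suc r) * C
    regroup = solve-∀

-- Closed walks with a repeated colour or vertex

module _ {n : ℕ} {B : Mat n} (sB : Sym B) (R : ℕ) (row : ∀ x → ∑ (λ y → B x y * B x y) ≤ R) where
  open MonoidSolver (matMonoid n) using (solve; _⊜_; _⊕_)

  private
    rotate : ∀ (P : Mat n) i b → tr ((𝟙 · B ^^ i) · P · B ^^ b) ≡ tr (P · B ^^ (b + i))
    rotate P i b = begin
      tr ((𝟙 · B ^^ i) · P · B ^^ b)   ≡⟨ tr-cong (·-congʳ {B = P · B ^^ b} (·-identityˡ (B ^^ i))) ⟩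
      tr (B ^^ i · P · B ^^ b)         ≡⟨ tr-comm (B ^^ i) _ ⟩
      tr ((P · B ^^ b) · B ^^ i)       ≡⟨ tr-cong (≐-trans (·-assoc P (B ^^ b) (B ^^ i)) (·-congˡ {A = P} (≐-sym (^^-+ B b i)))) ⟩
      tr (P · B ^^ (b + i))            ∎
      where open ≡-Reasoning

  module _ {L : ℕ} (ℓ : Fin n → Fin n → Fin L) (sX : ∀ c → Sym (LabelledWalks.X B ℓ c))
    (proper : ∀ x y z → B x y ≢ 0 → B x z ≢ 0 → ℓ x y ≡ ℓ x z → y ≡ z) where
    open LabelledWalks B ℓ

    private
      -- By properness, a step followed by one of the same colour backtracks.
      ∑XX≤ : ∀ x z → ∑ (λ c → (X c · X c) x z) ≤ R * 𝟙 x z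
      ∑XX≤ x z = begin
        ∑ (λ c → ∑ λ y → X c x y * X c y z)    ≡⟨ ∑-cong (λ c → ∑-cong λ y → *-comm (X c x y) _) ⟩
        ∑ (λ c → ∑ λ y → X c y z * X c x y)    ≡⟨ ∑-comm (λ c y → X c y z * X c x y) ⟩
        ∑ (λ y → ∑ λ c → X c y z * X c x y)    ≡⟨ ∑-cong (λ y → ∑-cong λ c → trans (*-comm (X c y z) _) (trans (*-assoc ⟦ c Fin.≟ ℓ x y ⟧ (B x y) (X c y z)) (cong (_* (B x y * X c y z)) (δ-sym c (ℓ x y))))) ⟩
        ∑ (λ y → ∑ λ c → ⟦ ℓ x y Fin.≟ c ⟧ * (B x y * X c y z)) ≡⟨ ∑-cong (λ y → ∑-δ (λ c → B x y * X c y z) (ℓ x y)) ⟩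
        ∑ (λ y → B x y * X (ℓ x y) y z)        ≤⟨ ∑-mono entry ⟩
        ∑ (λ y → B x y * B x y * 𝟙 x z)        ≡⟨ ∑-* (𝟙 x z) _ ⟨
        ∑ (λ y → B x y * B x y) * 𝟙 x z        ≤⟨ *-monoˡ-≤ (𝟙 x z) (row x) ⟩
        R * 𝟙 x z                              ∎
        where
        open ≤-Reasoning
        entry : ∀ y → B x y * X (ℓ x y) y z ≤ B x y * B x y * 𝟙 x z
        entry y with x Fin.≟ z
        ... | yes refl = begin
          B x y * X (ℓ x y) y x  ≡⟨ cong (B x y *_) (sX (ℓ x y) x y) ⟩
          B x y * X (ℓ x y) x y  ≤⟨ *-monoʳ-≤ (B x y) (δ*≤ (ℓ x y) (ℓ x y) (B x y)) ⟩
          B x y * B x y          ≡⟨ *-identityʳ _ ⟨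
          B x y * B x y * 1      ∎
        ... | no x≢z = ≤-trans (≤-reflexive vanish) z≤n
          where
          nonzero-X : ∀ c u v → X c u v ≢ 0 → c ≡ ℓ u v × B u v ≢ 0
          nonzero-X c u v nz with c Fin.≟ ℓ u v
          ... | yes p = p , nz ∘ trans (+-identityʳ _)
          ... | no  _ = contradiction refl nz
          vanish : B x y * X (ℓ x y) y z ≡ 0
          vanish with B x y ≟ 0 | X (ℓ x y) y z ≟ 0
          ... | yes p | _     = cong (_* X (ℓ x y) y z) p
          ... | no _  | yes q = trans (cong (B x y *_) q) (*-zeroʳ (B x y))
          ... | no p  | no q  with ℓxy≡ℓyz , Byz≢0 ← nonzero-X (ℓ x y) y z q
                                 | ℓxy≡ℓyx , Byx≢0 ← nonzero-X (ℓ x y) y x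
                                     (λ eq → p (trans (sym (trans (cong (_* B x y) (δ-refl (ℓ x y))) (+-identityʳ _))) (trans (sym (sX (ℓ x y) x y)) eq)))
            = contradiction (proper y x z Byx≢0 Byz≢0 (trans (sym ℓxy≡ℓyx) ℓxy≡ℓyz)) x≢z

      -- The extreme case: the two equally coloured steps are consecutive, and `P` is the rest of
      -- the closed walk.
      end : ∀ (P : Mat n) → ∑ (λ c → tr ((X c · X c) · P)) ≤ R * tr P
      end P = begin
        ∑ (λ c → tr ((X c · X c) · P))                        ≡⟨ ∑-cong (λ c → tr-comm (X c · X c) P) ⟩
        ∑ (λ c → tr (P · X c · X c))                          ≡⟨ tr-·-∑ P (λ c → X c · X c) ⟨
        tr (P · λ x z → ∑ λ c → (X c · X c) x z)              ≤⟨ ∑-mono (λ x → ∑-mono λ z → *-monoʳ-≤ (P x z) (∑XX≤ z x)) ⟩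
        tr (P · λ x z → R * 𝟙 x z)                            ≡⟨ ∑-cong (λ x → trans (∑-cong λ z → swap (P x z) R (𝟙 z x)) (sym (*-∑ R _))) ⟩
        ∑ (λ x → R * (P · 𝟙) x x)                             ≡⟨ *-∑ R _ ⟨
        R * tr (P · 𝟙)                                        ≡⟨ cong (R *_) (tr-cong (·-identityʳ P)) ⟩
        R * tr P                                              ∎
        where
        open ≤-Reasoning
        swap : ∀ a b c → a * (b * c) ≡ b * (a * c)
        swap = solve-∀

    -- Fix the positions of the two equally coloured steps. Rotating the closed walk leaves two gaps
    -- with sum `m + m`, and by convexity the total is largest when one gap is empty, where `end`
    -- applies.
    edge-repetitions≤ : ∀ m → tr (Rep (suc (m + m))) ≤
      (2 + (m + m)) * (2 + (m + m)) * (R * tr (B ^^ (m + m)))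
    edge-repetitions≤ m = begin
      tr (Rep (suc (m + m)))       ≡⟨ tr-cong (·-identityˡ _) ⟨
      tr (𝟙 · Rep (suc (m + m)))   ≤⟨ tr-Rep≤ (suc (m + m)) 𝟙 (R * tr (B ^^ (m + m))) hyp ⟩
      (2 + (m + m)) * (2 + (m + m)) * (R * tr (B ^^ (m + m))) ∎
      where
      open ≤-Reasoning
      G : ℕ → ℕ → ℕ
      G a b = ∑ λ c → tr (X c · B ^^ a · X c · B ^^ b)
      conv : ∀ p p′ q q′ → 2 * G (p + p′) (q + q′) ≤ G (p + p) (q + q) + G (p′ + p′) (q′ + q′)
      conv p p′ q q′ = begin
        2 * G (p + p′) (q + q′)       ≡⟨ *-∑ 2 _ ⟩
        ∑ (λ c → 2 * tr (X c · B ^^ (p + p′) · X c · B ^^ (q + q′)))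
          ≤⟨ ∑-mono (λ c → tr-XBXB-convex sB (sX c) p p′ q q′) ⟩
        ∑ (λ c → tr (X c · B ^^ (p + p) · X c · B ^^ (q + q)) + tr (X c · B ^^ (p′ + p′) · X c · B ^^ (q′ + q′)))
          ≡⟨ ∑-+ (λ c → tr (X c · B ^^ (p + p) · X c · B ^^ (q + q))) _ ⟩
        G (p + p) (q + q) + G (p′ + p′) (q′ + q′) ∎
      endˡ : G 0 (m + m) ≤ R * tr (B ^^ (m + m))
      endˡ = ≤-trans (≤-reflexive (∑-cong λ c → tr-cong (≐-trans
        (·-congˡ {A = X c} (·-identityˡ (X c · B ^^ (m + m)))) (≐-sym (·-assoc (X c) (X c) _)))))
        (end (B ^^ (m + m)))
      endʳ : G (m + m) 0 ≤ R * tr (B ^^ (m + m))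
      endʳ = ≤-trans (≤-reflexive (∑-cong λ c → trans
        (trans (tr-cong (solve 3 (λ x b i → x ⊕ (b ⊕ (x ⊕ i)) ⊜ (x ⊕ b) ⊕ (x ⊕ i)) (λ _ _ → refl) (X c) (B ^^ (m + m)) 𝟙))
               (tr-comm (X c · B ^^ (m + m)) (X c · 𝟙)))
        (tr-cong (≐-trans (·-congʳ {B = X c · B ^^ (m + m)} (·-identityʳ (X c))) (≐-sym (·-assoc (X c) (X c) _))))))
        (end (B ^^ (m + m)))
      reindex : ∀ i a b → a + (b + i) ≡ i + a + b
      reindex = solve-∀
      hyp : ∀ i a b → suc (i + a + b) ≡ suc (m + m) →
        ∑ (λ c → tr ((𝟙 · B ^^ i) · X c · B ^^ a · X c · B ^^ b)) ≤ R * tr (B ^^ (m + m))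
      hyp i a b eq = begin
        ∑ (λ c → tr ((𝟙 · B ^^ i) · X c · B ^^ a · X c · B ^^ b))
          ≡⟨ ∑-cong (λ c → trans (tr-cong (·-congˡ {A = 𝟙 · B ^^ i} (reassoc c))) (trans (rotate (X c · B ^^ a · X c) i b) (tr-cong (≐-sym (reassoc′ c))))) ⟩
        G a (b + i)
          ≤⟨ line-convex⇒≤ends G m _ conv endˡ endʳ a (b + i) (trans (reindex i a b) (suc-injective eq)) ⟩
        R * tr (B ^^ (m + m)) ∎
        where
        reassoc : ∀ c → X c · B ^^ a · X c · B ^^ b ≐ (X c · B ^^ a · X c) · B ^^ b
        reassoc c = solve 3 (λ x a b → x ⊕ (a ⊕ (x ⊕ b)) ⊜ (x ⊕ (a ⊕ x)) ⊕ b) (λ _ _ → refl) (X c) (B ^^ a) (B ^^ b)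
        reassoc′ : ∀ c → X c · B ^^ a · X c · B ^^ (b + i) ≐ (X c · B ^^ a · X c) · B ^^ (b + i)
        reassoc′ c = solve 3 (λ x a b → x ⊕ (a ⊕ (x ⊕ b)) ⊜ (x ⊕ (a ⊕ x)) ⊕ b) (λ _ _ → refl) (X c) (B ^^ a) (B ^^ (b + i))

  module _ (loopless : ∀ x → B x x ≡ 0) where
    open LabelledWalks B (λ x _ → x)

    private
      -- The projection to the vertex `v`. It is symmetric, as the convexity argument requires,
      -- while the matrix `X v` of steps leaving `v` need not be.
      E : Fin n → Mat n
      E v x y = ⟦ v Fin.≟ x ⟧ * ⟦ v Fin.≟ y ⟧

      E-sym : ∀ v → Sym (E v)
      E-sym v x y = *-comm ⟦ v Fin.≟ y ⟧ _

      E·P : ∀ v (P : Mat n) x y → (E v · P) x y ≡ ⟦ v Fin.≟ x ⟧ * P v y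
      E·P v P x y = trans (∑-cong λ z → *-assoc ⟦ v Fin.≟ x ⟧ ⟦ v Fin.≟ z ⟧ (P z y))
        (trans (sym (*-∑ ⟦ v Fin.≟ x ⟧ _)) (cong (⟦ v Fin.≟ x ⟧ *_) (∑-δ (λ z → P z y) v)))

      tr-E : ∀ v (P : Mat n) → tr (E v · P) ≡ P v v
      tr-E v P = trans (∑-cong λ x → E·P v P x x) (∑-δ (λ x → P v x) v)

      tr-EPEQ : ∀ v (P Q : Mat n) → tr (E v · P · E v · Q) ≡ P v v * Q v v
      tr-EPEQ v P Q = begin
        tr (E v · P · E v · Q)                     ≡⟨ tr-E v (P · E v · Q) ⟩
        ∑ (λ z → P v z * (E v · Q) z v)            ≡⟨ ∑-cong (λ z → trans (cong (P v z *_) (E·P v Q z v)) (swap (P v z) ⟦ v Fin.≟ z ⟧ (Q v v))) ⟩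
        ∑ (λ z → ⟦ v Fin.≟ z ⟧ * (P v z * Q v v))  ≡⟨ ∑-δ (λ z → P v z * Q v v) v ⟩
        P v v * Q v v                              ∎
        where
        open ≡-Reasoning
        swap : ∀ a b c → a * (b * c) ≡ b * (a * c)
        swap = solve-∀

      -- A step leaving `v` is the projection to `v` followed by any step; this moves the label from
      -- the step to the vertex.
      X≐EB : ∀ v → X v ≐ E v · B
      X≐EB v x y = trans (restrict v x y) (sym (E·P v B x y))
        where
        restrict : ∀ v x y → ⟦ v Fin.≟ x ⟧ * B x y ≡ ⟦ v Fin.≟ x ⟧ * B v y
        restrict v x y with v Fin.≟ x
        ... | yes refl = refl
        ... | no  _    = refl

    -- Two visits to `v` cut the closed walk into two closed walks at `v`. By convexity the extreme
    -- case is that one of them has length 2, and its weight `(B ^^ 2) v v` is a squared row norm,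
    -- at most `R`.
    vertex-repetitions≤ : ∀ j → tr (Rep (suc (suc j + suc j))) ≤
      (2 + (suc j + suc j)) * (2 + (suc j + suc j)) * (R * tr (B ^^ (suc j + suc j)))
    vertex-repetitions≤ j = begin
      tr (Rep (suc (suc j + suc j)))       ≡⟨ tr-cong (·-identityˡ _) ⟨
      tr (𝟙 · Rep (suc (suc j + suc j)))   ≤⟨ tr-Rep≤ (suc (suc j + suc j)) 𝟙 C hyp ⟩
      (2 + (suc j + suc j)) * (2 + (suc j + suc j)) * C ∎
      where
      open ≤-Reasoning
      C : ℕ
      C = R * tr (B ^^ (suc j + suc j))
      -- Shifted by 2, since the endpoint a = 0 would give no gain and a = 1 contributes nothing.
      G : ℕ → ℕ → ℕ
      G a b = ∑ λ v → tr (E v · B ^^ (2 + a) · E v · B ^^ (2 + b))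
      shift : ∀ p q → 2 + (p + q) ≡ suc p + suc q
      shift = solve-∀
      conv : ∀ p p′ q q′ → 2 * G (p + p′) (q + q′) ≤ G (p + p) (q + q) + G (p′ + p′) (q′ + q′)
      conv p p′ q q′ = begin
        2 * G (p + p′) (q + q′)       ≡⟨ *-∑ 2 _ ⟩
        ∑ (λ v → 2 * H v (2 + (p + p′)) (2 + (q + q′)))
          ≡⟨ ∑-cong (λ v → cong₂ (λ a b → 2 * H v a b) (shift p p′) (shift q q′)) ⟩
        ∑ (λ v → 2 * H v (suc p + suc p′) (suc q + suc q′))
          ≤⟨ ∑-mono (λ v → tr-XBXB-convex sB (E-sym v) (suc p) (suc p′) (suc q) (suc q′)) ⟩
        ∑ (λ v → H v (suc p + suc p) (suc q + suc q) + H v (suc p′ + suc p′) (suc q′ + suc q′))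
          ≡⟨ ∑-cong (λ v → cong₂ _+_ (cong₂ (H v) (shift p p) (shift q q)) (cong₂ (H v) (shift p′ p′) (shift q′ q′))) ⟨
        ∑ (λ v → H v (2 + (p + p)) (2 + (q + q)) + H v (2 + (p′ + p′)) (2 + (q′ + q′)))
          ≡⟨ ∑-+ (λ v → H v (2 + (p + p)) (2 + (q + q))) _ ⟩
        G (p + p) (q + q) + G (p′ + p′) (q′ + q′) ∎
        where
        H : Fin n → ℕ → ℕ → ℕ
        H v a b = tr (E v · B ^^ a · E v · B ^^ b)
      B²vv≤R : ∀ v → (B ^^ 2) v v ≤ R
      B²vv≤R v = begin
        ∑ (λ z → B v z * (B ^^ 1) z v)   ≡⟨ ∑-cong (λ z → cong (B v z *_) (trans (^^-1 B z v) (sB v z))) ⟩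
        ∑ (λ z → B v z * B v z)          ≤⟨ row v ⟩
        R                                ∎
      endˡ : G 0 (j + j) ≤ C
      endˡ = begin
        ∑ (λ v → tr (E v · B ^^ 2 · E v · B ^^ (2 + (j + j))))   ≡⟨ ∑-cong (λ v → tr-EPEQ v (B ^^ 2) (B ^^ (2 + (j + j)))) ⟩
        ∑ (λ v → (B ^^ 2) v v * (B ^^ (2 + (j + j))) v v)        ≤⟨ ∑-mono (λ v → *-monoˡ-≤ ((B ^^ (2 + (j + j))) v v) (B²vv≤R v)) ⟩
        ∑ (λ v → R * (B ^^ (2 + (j + j))) v v)                   ≡⟨ *-∑ R _ ⟨
        R * tr (B ^^ (2 + (j + j)))                              ≡⟨ cong (λ e → R * tr (B ^^ e)) (shift j j) ⟩
        C                                                        ∎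
      endʳ : G (j + j) 0 ≤ C
      endʳ = ≤-trans (≤-reflexive (∑-cong λ v → trans (tr-EPEQ v (B ^^ (2 + (j + j))) (B ^^ 2))
        (trans (*-comm ((B ^^ (2 + (j + j))) v v) _) (sym (tr-EPEQ v (B ^^ 2) (B ^^ (2 + (j + j)))))))) endˡ
      reindex : ∀ i a b → a + (b + i) ≡ i + a + b
      reindex = solve-∀
      B¹vv≡0 : ∀ v → (B ^^ 1) v v ≡ 0
      B¹vv≡0 v = trans (^^-1 B v v) (loopless v)
      bound : ∀ a b → a + b ≡ suc j + suc j → ∑ (λ v → tr (E v · B ^^ suc a · E v · B ^^ suc b)) ≤ C
      bound zero    b eq = ≤-trans (≤-reflexive (∑-zero λ v → trans (tr-EPEQ v (B ^^ 1) (B ^^ suc b)) (cong (_* (B ^^ suc b) v v) (B¹vv≡0 v)))) z≤n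
      bound (suc a) zero eq = ≤-trans (≤-reflexive (∑-zero λ v → trans (tr-EPEQ v (B ^^ (2 + a)) (B ^^ 1)) (trans (cong ((B ^^ (2 + a)) v v *_) (B¹vv≡0 v)) (*-zeroʳ ((B ^^ (2 + a)) v v))))) z≤n
      bound (suc a) (suc b) eq = line-convex⇒≤ends G j C conv endˡ endʳ a b
        (suc-injective (trans (sym (+-suc a b)) (trans (suc-injective eq) (+-suc j j))))
      hyp : ∀ i a b → suc (i + a + b) ≡ suc (suc j + suc j) →
        ∑ (λ v → tr ((𝟙 · B ^^ i) · X v · B ^^ a · X v · B ^^ b)) ≤ C
      hyp i a b eq = begin
        ∑ (λ v → tr ((𝟙 · B ^^ i) · X v · B ^^ a · X v · B ^^ b))
          ≡⟨ ∑-cong (λ v → trans (tr-cong (·-congˡ {A = 𝟙 · B ^^ i} (≐-trans (reassoc v)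
               (·-congˡ {A = E v · B ^^ suc a · E v} (≐-refl {x = B ^^ suc b})))))
               (trans (rotate (E v · B ^^ suc a · E v) i (suc b)) (tr-cong (reassoc′ v)))) ⟩
        ∑ (λ v → tr (E v · B ^^ suc a · E v · B ^^ suc (b + i)))
          ≤⟨ bound a (b + i) (trans (reindex i a b) (suc-injective eq)) ⟩
        C ∎
        where
        reassoc : ∀ v → X v · B ^^ a · X v · B ^^ b ≐ (E v · B ^^ suc a · E v) · B ^^ suc b
        reassoc v = ≐-trans (·-cong (X≐EB v) (·-congˡ {A = B ^^ a} (·-congʳ {B = B ^^ b} (X≐EB v))))
          (solve 4 (λ e b p q → (e ⊕ b) ⊕ (p ⊕ ((e ⊕ b) ⊕ q)) ⊜ (e ⊕ ((b ⊕ p) ⊕ e)) ⊕ (b ⊕ q)) (λ _ _ → refl)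
            (E v) B (B ^^ a) (B ^^ b))
        reassoc′ : ∀ v → (E v · B ^^ suc a · E v) · B ^^ suc (b + i) ≐ E v · B ^^ suc a · E v · B ^^ suc (b + i)
        reassoc′ v = solve 3 (λ e p q → (e ⊕ (p ⊕ e)) ⊕ q ⊜ e ⊕ (p ⊕ (e ⊕ q))) (λ _ _ → refl)
          (E v) (B ^^ suc a) (B ^^ suc (b + i))

-- Integer scaling for the normalised adjacency matrix

^-distribʳ-* : ∀ k a b → (a * b) ^ k ≡ a ^ k * b ^ k
^-distribʳ-* zero    a b = refl
^-distribʳ-* (suc k) a b = trans (cong (a * b *_) (^-distribʳ-* k a b)) (interchange a b (a ^ k) (b ^ k))
  where
  interchange : ∀ a b c d → a * b * (c * d) ≡ a * c * (b * d)
  interchange = solve-∀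

sqrt : ∀ d → ∃ λ u → u * u ≤ d × d < suc u * suc u
sqrt zero = 0 , z≤n , z<s
sqrt (suc d) with sqrt d
... | u , lo , hi with suc u * suc u ≤? suc d
...   | yes p = suc u , p , ≤-<-trans hi (*-mono-< {suc u} {2 + u} {suc u} {2 + u} ≤-refl ≤-refl)
...   | no ¬p = u , m≤n⇒m≤1+n lo , ≰⇒> ¬p

-- Up to a factor of 2, u is √d and r is n!/√d.
record Scale (n d : ℕ) : Set where
  field
    r u    : ℕ
    u²≤d   : u * u ≤ d
    r²d≤4N : r * r * d ≤ 4 * (n ! * n !)
    r*u≡n! : 0 < d → r * u ≡ n !

-- Take `u` to be the integer part of the square root of `d`. As `u ≤ d ≤ n`, it divides `n !`, so
-- one common multiple serves all degrees and `r` is an exact quotient.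
scale : ∀ n d → d ≤ n → Scale n d
scale n zero    _   = record { r = 0 ; u = 0 ; u²≤d = z≤n ; r²d≤4N = z≤n ; r*u≡n! = λ () }
scale n d@(suc _) d≤n with sqrt d
... | zero  , _  , s≤s ()
... | u@(suc v) , lo , hi with divides r n!≡r*u ← ∣-trans (m∣m*n {u} (v !)) (m≤n⇒m!∣n! (≤-trans (m≤m*n u u) (≤-trans lo d≤n)))
  = record { r = r ; u = u ; u²≤d = lo ; r*u≡n! = λ _ → sym n!≡r*u ; r²d≤4N = bound }
  where
  open ≤-Reasoning
  2u² : ∀ u → 2 * u * (2 * u) ≡ 4 * (u * u)
  2u² = solve-∀
  regroup : ∀ r u → r * r * (4 * (u * u)) ≡ 4 * (r * u * (r * u))
  regroup = solve-∀
  bound : r * r * d ≤ 4 * (n ! * n !)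
  bound = begin
    r * r * d                   ≤⟨ *-monoʳ-≤ (r * r) (<⇒≤ hi) ⟩
    -- `suc u` is at most `u + u` because `u` is positive; hence the factor 4.
    r * r * (suc u * suc u)     ≤⟨ *-monoʳ-≤ (r * r) (*-mono-≤ (+-monoʳ-≤ 1 (m≤n+m u v)) (+-monoʳ-≤ 1 (m≤n+m u v))) ⟩
    r * r * ((u + u) * (u + u)) ≡⟨ cong (λ w → r * r * (w * w)) (cong (u +_) (+-identityʳ u)) ⟨
    r * r * (2 * u * (2 * u))   ≡⟨ cong (r * r *_) (2u² u) ⟩
    r * r * (4 * (u * u))       ≡⟨ regroup r u ⟩
    4 * (r * u * (r * u))       ≡⟨ cong₂ (λ a b → 4 * (a * b)) n!≡r*u n!≡r*u ⟨
    4 * (n ! * n !)             ∎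

bit : Bool → ℕ
bit b = if b then 1 else 0

degree : ∀ {n} → (Fin n → Fin n → Bool) → Fin n → ℕ
degree A x = ∑ λ y → bit (A x y)

degree≤n : ∀ {n} (A : Fin n → Fin n → Bool) x → degree A x ≤ n
degree≤n {n} A x = subst (degree A x ≤_) (trans (∑-const n 1) (*-identityʳ n)) (∑-mono λ y → bit≤1 (A x y))
  where
  bit≤1 : ∀ b → bit b ≤ 1
  bit≤1 true  = ≤-refl
  bit≤1 false = z≤n

-- Minimum degree of graphs without rainbow even cycles

module _ {n L j : ℕ} (A : Fin n → Fin n → Bool) (ℓ : Fin n → Fin n → Fin L)
  (A-sym : ∀ x y → A x y ≡ A y x) (A-irrefl : ∀ x → A x x ≡ false)
  (ℓ-sym : ∀ x y → A x y ≡ true → ℓ x y ≡ ℓ y x)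
  (ℓ-proper : ∀ x y z → A x y ≡ true → A x z ≡ true → ℓ x y ≡ ℓ x z → y ≡ z)
  (noRainbow : ∀ s (ys : Vec (Fin n) (suc (suc j + suc j))) → VecAll.All (_≡ true) (steps A s ys s) →
    UniqueVec (s ∷ ys) → UniqueVec (steps ℓ s ys s) → ⊥)
  where

  private
    module Sc x = Scale (scale n (degree A x) (degree≤n A x))
    open Sc

    N M : ℕ
    N = n ! * n !
    M = 2 + (suc j + suc j)

    -- Approximately (n!)² D^{-1/2} A D^{-1/2}, where D is the diagonal matrix of degrees.
    B : Mat n
    B x y = r x * bit (A x y) * r y

    sB : Sym B
    sB x y = trans (cong (λ b → r y * bit b * r x) (A-sym y x)) (swap (r y) (bit (A x y)) (r x))
      where
      swap : ∀ a b c → a * b * c ≡ c * b * a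
      swap = solve-∀

    B≢0⇒A : ∀ x y → B x y ≢ 0 → A x y ≡ true
    B≢0⇒A x y nz with A x y
    ... | true  = refl
    ... | false = contradiction (cong (_* r y) (*-zeroʳ (r x))) nz

    loopless : ∀ x → B x x ≡ 0
    loopless x rewrite A-irrefl x = cong (_* r x) (*-zeroʳ (r x))

    module Vertices = LabelledWalks B (λ x _ → x)
    module Colours = LabelledWalks B ℓ

    sX : ∀ c → Sym (Colours.X c)
    sX c x y with A x y in eq
    ... | true  = cong₂ (λ l b → ⟦ c Fin.≟ l ⟧ * b) (sym (ℓ-sym x y eq)) (trans (sB x y) (cong (λ b → r x * bit b * r y) eq))
    ... | false rewrite trans (A-sym y x) eq | *-zeroʳ (r x) | *-zeroʳ (r y) = trans (*-zeroʳ ⟦ c Fin.≟ ℓ y x ⟧) (sym (*-zeroʳ ⟦ c Fin.≟ ℓ x y ⟧))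

    weight≢0⇒edges : ∀ {m} s (ys : Vec (Fin n) m) t → weight B s ys t ≢ 0 → VecAll.All (_≡ true) (steps A s ys t)
    weight≢0⇒edges s []       t nz = B≢0⇒A s t nz ∷ []
    weight≢0⇒edges s (y ∷ ys) t nz =
      B≢0⇒A s y (λ z → nz (cong (_* weight B y ys t) z)) ∷
      weight≢0⇒edges y ys t (λ z → nz (trans (cong (B s y *_) z) (*-zeroʳ (B s y))))

    -- A closed walk of nonzero weight runs along edges. Since it is not a rainbow cycle, a vertex
    -- or a colour repeats, so at least one of the two sums counts it.
    tr≤repetitions : tr (B ^^ M) ≤ tr (Vertices.Rep (suc (suc j + suc j))) + tr (Colours.Rep (suc (suc j + suc j)))
    tr≤repetitions = begin
      tr (B ^^ M)                                   ≡⟨ tr-cong (walks B m) ⟨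
      ∑ (λ s → ∑ᵥ m λ ys → weight B s ys s)         ≤⟨ ∑-mono (λ s → ∑ᵥ-mono m (repeats s)) ⟩
      ∑ (λ s → ∑ᵥ m λ ys → weight B s ys s * vs s ys + weight B s ys s * cs s ys)
        ≡⟨ ∑-cong (λ s → ∑ᵥ-+ m (λ ys → weight B s ys s * vs s ys) (λ ys → weight B s ys s * cs s ys)) ⟩
      ∑ (λ s → Vertices.Rep m s s + Colours.Rep m s s) ≡⟨ ∑-+ (λ s → Vertices.Rep m s s) _ ⟩
      tr (Vertices.Rep m) + tr (Colours.Rep m)      ∎
      where
      open ≤-Reasoning
      m : ℕ
      m = suc (suc j + suc j)
      vs cs : Fin n → Vec (Fin n) m → ℕ
      vs s ys = repetitions (steps (λ x _ → x) s ys s)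
      cs s ys = repetitions (steps ℓ s ys s)
      repeats : ∀ s ys → weight B s ys s ≤ weight B s ys s * vs s ys + weight B s ys s * cs s ys
      repeats s ys with vs s ys in eqv | cs s ys in eqc
      ... | suc v | c     = ≤-trans (m≤m*n _ (suc v)) (m≤m+n _ _)
      ... | zero  | suc c = ≤-trans (m≤m*n _ (suc c)) (m≤n+m _ (weight B s ys s * 0))
      ... | zero  | zero with weight B s ys s ≟ 0
      ...   | yes p = ≤-trans (≤-reflexive p) z≤n
      ...   | no nz with () ← noRainbow s ys (weight≢0⇒edges s ys s nz)
                       (subst UniqueVec (steps-source s ys s) (repetitions≡0⇒Unique _ eqv))
                       (repetitions≡0⇒Unique _ eqc)

    -- For a neighbour `y` of `x`, `δ` is at most the degree of `y`, so `r y * r y * δ` is at most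
    -- `4 * N`. Summing over `y` leaves `r x * r x * degree A x`, which is again at most `4 * N`.
    r-row : ∀ δ → (∀ x y → A x y ≡ true → δ ≤ degree A y) → ∀ x → δ * ∑ (λ y → B x y * B x y) ≤ 16 * (N * N)
    r-row δ mindeg x = begin
      δ * ∑ (λ y → B x y * B x y)                     ≡⟨ *-∑ δ _ ⟩
      ∑ (λ y → δ * (B x y * B x y))                   ≤⟨ ∑-mono entry ⟩
      ∑ (λ y → r x * r x * (4 * N) * bit (A x y))     ≡⟨ *-∑ (r x * r x * (4 * N)) _ ⟨
      r x * r x * (4 * N) * degree A x                ≡⟨ regroup (r x * r x) (4 * N) (degree A x) ⟩
      4 * N * (r x * r x * degree A x)                ≤⟨ *-monoʳ-≤ (4 * N) (r²d≤4N x) ⟩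
      4 * N * (4 * N)                                 ≡⟨ sixteen N ⟩
      16 * (N * N)                                    ∎
      where
      open ≤-Reasoning
      regroup : ∀ a b c → a * b * c ≡ b * (a * c)
      regroup = solve-∀
      sixteen : ∀ a → 4 * a * (4 * a) ≡ 16 * (a * a)
      sixteen = solve-∀
      arrange : ∀ δ a b → δ * (a * 1 * b * (a * 1 * b)) ≡ a * a * (b * b * δ)
      arrange = solve-∀
      entry : ∀ y → δ * (B x y * B x y) ≤ r x * r x * (4 * N) * bit (A x y)
      entry y with A x y in eq
      ... | false rewrite *-zeroʳ (r x) | *-zeroʳ δ = z≤n
      ... | true  = begin
        δ * (r x * 1 * r y * (r x * 1 * r y))   ≡⟨ arrange δ (r x) (r y) ⟩
        r x * r x * (r y * r y * δ)             ≤⟨ *-monoʳ-≤ (r x * r x) (*-monoʳ-≤ (r y * r y) (mindeg x y eq)) ⟩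
        r x * r x * (r y * r y * degree A y)    ≤⟨ *-monoʳ-≤ (r x * r x) (r²d≤4N y) ⟩
        r x * r x * (4 * N)                     ≡⟨ *-identityʳ _ ⟨
        r x * r x * (4 * N) * 1                 ∎

    edge⇒0<degree : ∀ x y → A x y ≡ true → 0 < degree A y
    edge⇒0<degree x y eq = ≤-trans (≤-reflexive (cong bit (sym (trans (A-sym y x) eq)))) (term≤∑ (λ z → bit (A y z)) x)

    -- The vector of square roots of the degrees is an eigenvector of the normalised adjacency
    -- matrix, with eigenvalue 1. After rounding, `r y * u y` is still exactly `n !` on neighbours
    -- `y`, and `u x * u x ≤ degree A x` gives the inequality.
    supereigenvector : ∀ x → N * u x ≤ ∑ λ y → B x y * u y
    supereigenvector x = begin
      N * u x                                   ≤⟨ lower (degree A x) refl ⟩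
      r x * n ! * degree A x                    ≡⟨ *-∑ (r x * n !) _ ⟩
      ∑ (λ y → r x * n ! * bit (A x y))         ≡⟨ ∑-cong entry ⟩
      ∑ (λ y → B x y * u y)                     ∎
      where
      open ≤-Reasoning
      arrange : ∀ a b c → a * b * (c * a) ≡ a * c * b * a
      arrange = solve-∀
      entry : ∀ y → r x * n ! * bit (A x y) ≡ B x y * u y
      entry y with A x y in eq
      ... | true rewrite sym (r*u≡n! y (edge⇒0<degree x y eq)) = shuffle (r x) (r y) (u y)
        where
        shuffle : ∀ a b c → a * (b * c) * 1 ≡ a * 1 * b * c
        shuffle = solve-∀
      ... | false rewrite *-zeroʳ (r x) = *-zeroʳ (r x * n !)
      assemble : ∀ a b c → a * b * c * b ≡ a * c * (b * b)
      assemble = solve-∀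
      lower : ∀ d → degree A x ≡ d → N * u x ≤ r x * n ! * degree A x
      lower zero    eq with u x in equ | u²≤d x
      ... | zero  | _ = ≤-trans (≤-reflexive (*-zeroʳ N)) z≤n
      ... | suc _ | p with () ← ≤-trans (≤-reflexive (cong (λ v → v * v) (sym equ))) (≤-trans (u²≤d x) (≤-reflexive eq))
      lower (suc d) eq = begin
        n ! * n ! * u x              ≡⟨ cong (λ f → f * n ! * u x) (r*u≡n! x (subst (0 <_) (sym eq) z<s)) ⟨
        r x * u x * n ! * u x        ≡⟨ assemble (r x) (u x) (n !) ⟩
        r x * n ! * (u x * u x)      ≤⟨ *-monoʳ-≤ (r x * n !) (u²≤d x) ⟩
        r x * n ! * degree A x       ∎

  -- The supereigenvector bounds the trace of `B ^^ (k + k)` from below, the repetition bounds and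
  -- `descent` bound it from above. The edge `a b` makes the vector `u` nonzero.
  minDegree-bound : ∀ δ .{{_ : NonZero δ}} → (∀ x y → A x y ≡ true → δ ≤ degree A y) →
    ∀ a b → A a b ≡ true → δ ^ (2 + j) ≤ (32 * (M * M)) ^ (2 + j) * n
  minDegree-bound δ mindeg a b Aab = *-cancelʳ-≤ _ _ (N ^ (k + k)) {{m^n≢0 N (k + k)}} (begin
    δ ^ k * N ^ (k + k)                    ≤⟨ *-monoʳ-≤ (δ ^ k) (supereigenvector⇒tr sB N u supereigenvector k 0<∑u²) ⟩
    δ ^ k * tr (B ^^ (k + k))              ≤⟨ descent sB δ E (suc j) one-step ⟩
    E ^ k * n                              ≡⟨ cong (_* n) (trans (^-distribʳ-* k (32 * (M * M)) (N * N)) (cong ((32 * (M * M)) ^ k *_) (trans (^-distribʳ-* k N N) (sym (^-distribˡ-+-* N k k))))) ⟩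
    (32 * (M * M)) ^ k * N ^ (k + k) * n   ≡⟨ swap ((32 * (M * M)) ^ k) (N ^ (k + k)) n ⟩
    (32 * (M * M)) ^ k * n * N ^ (k + k)   ∎)
    where
    open ≤-Reasoning
    -- `R` bounds the squared rows of `B`. In `E`, a factor 2 accounts for vertices and colours,
    -- `M * M` for the pairs of positions and `16 * (N * N)` for `R * δ`.
    k E R : ℕ
    k = 2 + j
    E = 32 * (M * M) * (N * N)
    R = (16 * (N * N)) / δ
    instance
      N≢0 : NonZero N
      N≢0 = m*n≢0 (n !) (n !) {{n !≢0}} {{n !≢0}}
      E≢0 : NonZero E
      E≢0 = m*n≢0 (32 * (M * M)) (N * N) {{_}} {{m*n≢0 N N}}
    swap : ∀ a b c → a * b * c ≡ a * c * b
    swap = solve-∀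
    0<∑u² : 0 < ∑ λ x → u x * u x
    0<∑u² with u b in eq | term≤∑ (λ x → u x * u x) b
    ... | suc v | p = ≤-trans (s≤s z≤n) p
    ... | zero  | p with () ← ≢-nonZero⁻¹ (n !) {{n !≢0}} (trans (sym (r*u≡n! b (edge⇒0<degree a b Aab))) (trans (cong (r b *_) eq) (*-zeroʳ (r b))))
    row : ∀ x → ∑ (λ y → B x y * B x y) ≤ R
    row x = subst (_≤ R) (m*n/n≡m _ δ) (/-mono-≤ (≤-trans (≤-reflexive (*-comm _ δ)) (r-row δ mindeg x)) (≤-refl {δ}))
    B-proper : ∀ x y z → B x y ≢ 0 → B x z ≢ 0 → ℓ x y ≡ ℓ x z → y ≡ z
    B-proper x y z p q = ℓ-proper x y z (B≢0⇒A x y p) (B≢0⇒A x z q)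
    t : ℕ
    t = tr (B ^^ (suc j + suc j))
    regroup : ∀ δ s R t → δ * (s * (R * t) + s * (R * t)) ≡ 2 * s * t * (R * δ)
    regroup = solve-∀
    regroup′ : ∀ s n t → 2 * s * t * (16 * n) ≡ 32 * s * n * t
    regroup′ = solve-∀
    one-step : δ * tr (B ^^ (k + k)) ≤ E * t
    one-step = begin
      δ * tr (B ^^ (k + k))                                ≡⟨ cong (λ e → δ * tr (B ^^ e)) (cong suc (+-suc (suc j) (suc j))) ⟩
      δ * tr (B ^^ M)                                      ≤⟨ *-monoʳ-≤ δ tr≤repetitions ⟩
      δ * (tr (Vertices.Rep (suc (suc j + suc j))) + tr (Colours.Rep (suc (suc j + suc j))))       ≤⟨ *-monoʳ-≤ δ (+-mono-≤ (vertex-repetitions≤ sB R row loopless j) (edge-repetitions≤ sB R row ℓ sX B-proper (suc j))) ⟩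
      δ * (M * M * (R * t) + M * M * (R * t))              ≡⟨ regroup δ (M * M) R t ⟩
      2 * (M * M) * t * (R * δ)                            ≤⟨ *-monoʳ-≤ (2 * (M * M) * t) (m/n*n≤m (16 * (N * N)) δ) ⟩
      2 * (M * M) * t * (16 * (N * N))                     ≡⟨ regroup′ (M * M) (N * N) t ⟩
      E * t                                                ∎

-- Counting and greedy choice in lists

module _ {A : Set} {P : A → Set} (P? : Decidable P) where

  length-filter-split : ∀ xs → length xs ≡ length (filter P? xs) + length (filter (¬? ∘ P?) xs)
  length-filter-split []       = refl
  length-filter-split (x ∷ xs) with P? x
  ... | yes _ = cong suc (length-filter-split xs)
  ... | no  _ = trans (cong suc (length-filter-split xs)) (sym (+-suc _ _))

  length-filter-∷ : ∀ x xs → length (filter P? (x ∷ xs)) ≡ ⟦ P? x ⟧ + length (filter P? xs)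
  length-filter-∷ x xs with does (P? x)
  ... | true  = refl
  ... | false = refl

InjectiveOn : ∀ {A B : Set} → (A → B) → List A → Set
InjectiveOn f xs = ∀ {x y} → x ∈ xs → y ∈ xs → f x ≡ f y → x ≡ y

Unique-map-on : ∀ {A B : Set} (f : A → B) (xs : List A) → InjectiveOn f xs → Unique xs → Unique (map f xs)
Unique-map-on f []       inj []            = []
Unique-map-on f (x ∷ xs) inj (x∉xs ∷ uniq) =
  All.tabulate (λ fy∈ fx≡fy → let y , y∈xs , eq = ∈-map⁻ f fy∈ in
    All.lookup x∉xs y∈xs (inj (here refl) (there y∈xs) (trans fx≡fy eq)))
  ∷ Unique-map-on f xs (λ p q → inj (there p) (there q)) uniq

module _ {n : ℕ} (p : Fin n → Bool) where
  private
    count : Fin n → List (Fin n) → ℕ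
    count y []       = 0
    count y (w ∷ ws) = ⟦ w Fin.≟ y ⟧ + count y ws

    ∑-count : ∀ ws → ∑ (λ y → count y ws) ≡ length ws
    ∑-count []       = ∑-zero λ _ → refl
    ∑-count (w ∷ ws) = trans (∑-+ (λ y → ⟦ w Fin.≟ y ⟧) _)
      (cong₂ _+_ (trans (∑-cong λ y → sym (*-identityʳ _)) (∑-δ (λ _ → 1) w)) (∑-count ws))

    count-∉ : ∀ y ws → All (_≢ y) ws → count y ws ≡ 0
    count-∉ y []       []           = refl
    count-∉ y (w ∷ ws) (w≢y ∷ ws≢y) with w Fin.≟ y
    ... | yes w≡y = contradiction w≡y w≢y
    ... | no  _   = count-∉ y ws ws≢y

    count≤ : ∀ y ws → Unique ws → All (λ w → p w ≡ true) ws → count y ws ≤ bit (p y)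
    count≤ y []       _             _          = z≤n
    count≤ y (w ∷ ws) (w∉ws ∷ uniq) (pw ∷ pws) with w Fin.≟ y
    ... | yes refl rewrite pw | count-∉ w ws (All.map (_∘ sym) w∉ws) = ≤-refl
    ... | no _ = count≤ y ws uniq pws

  length≤∑bit : ∀ ws → Unique ws → All (λ w → p w ≡ true) ws → length ws ≤ ∑ (λ y → bit (p y))
  length≤∑bit ws uniq pws = subst (_≤ _) (∑-count ws) (∑-mono λ y → count≤ y ws uniq pws)

module _ {A B : Set} (_≟ᴮ_ : DecidableEquality B) (f : A → B) where

  -- By injectivity at most one entry takes the value `b`.
  length≤1+filter-≢ : ∀ b ws → Unique ws → InjectiveOn f ws →
    length ws ≤ suc (length (filter (λ w → ¬? (f w ≟ᴮ b)) ws))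
  length≤1+filter-≢ b []       _             _   = z≤n
  length≤1+filter-≢ b (w ∷ ws) (w∉ws ∷ uniq) inj with f w ≟ᴮ b
  ... | no  _  = s≤s (length≤1+filter-≢ b ws uniq (λ p q → inj (there p) (there q)))
  ... | yes eq = s≤s (≤-reflexive (cong length (sym (filter-all (λ w → ¬? (f w ≟ᴮ b))
    (All.tabulate λ y∈ws fy≡b → All.lookup w∉ws y∈ws (inj (here refl) (there y∈ws) (trans eq (sym fy≡b))))))))

  -- The counting behind greedy choices: each forbidden value costs at most one candidate.
  avoid : ∀ {m} (forbidden : Vec B m) ws → Unique ws → InjectiveOn f ws →
    ∃ λ ws′ → Unique ws′ × (∀ {w} → w ∈ ws′ → w ∈ ws × VecAll.All (f w ≢_) forbidden) × length ws ≤ m + length ws′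
  avoid []               ws uniq inj = ws , uniq , (λ p → p , VecAll.[]) , ≤-refl
  avoid (b ∷ forbidden) ws uniq inj
    with ws′ , uniq′ , sub , len ← avoid forbidden ws uniq inj
    = filter ≢b ws′ , filter⁺ ≢b uniq′
    , (λ p → let q , r = ∈-filter⁻ ≢b {xs = ws′} p in proj₁ (sub q) , r VecAll.∷ proj₂ (sub q))
    , ≤-trans len (≤-trans (+-monoʳ-≤ _ (length≤1+filter-≢ b ws′ uniq′ (λ p q → inj (proj₁ (sub p)) (proj₁ (sub q)))))
        (≤-reflexive (+-suc _ _)))
    where
    ≢b : Decidable (λ w → f w ≢ b)
    ≢b w = ¬? (f w ≟ᴮ b)

-- Subgraphs of large minimum degree

module _ {K : Set} (_≟ᴷ_ : DecidableEquality K) where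

  -- Each edge is listed in one orientation only; adjacency is the symmetric closure.
  Joined : List (K × K) → K → K → Set
  Joined es x y = (x , y) ∈ es ⊎ (y , x) ∈ es

  -- The degree condition concerns only the vertices that lie on an edge of `core`; all others count
  -- as deleted.
  record Core (d : ℕ) (es : List (K × K)) : Set where
    field
      core       : List (K × K)
      core⊆      : ∀ {e} → e ∈ core → e ∈ es
      nonempty   : ∃ (_∈ core)
      neighbours : ∀ {x y} → Joined core x y →
        ∃ λ ws → Unique ws × d < length ws × (∀ {w} → w ∈ ws → Joined core x w)

  private
    Incident : K → K × K → Set
    Incident κ (x , y) = x ≡ κ ⊎ y ≡ κ

    incident? : ∀ κ → Decidable (Incident κ)
    incident? κ (x , y) = (x ≟ᴷ κ) ⊎-dec (y ≟ᴷ κ)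

    other : K → K × K → K
    other κ (x , y) with x ≟ᴷ κ
    ... | yes _ = y
    ... | no  _ = x

    other-joined : ∀ {κ e es} → Incident κ e → e ∈ es → Joined es κ (other κ e)
    other-joined {κ} {x , y} inc e∈es with x ≟ᴷ κ | inc
    ... | yes refl | _         = inj₁ e∈es
    ... | no  x≢κ  | inj₁ x≡κ  = contradiction x≡κ x≢κ
    ... | no  _    | inj₂ refl = inj₂ e∈es

    -- Incident edges with the same other end agree up to orientation, and asymmetry rules out
    -- opposite orientations.
    other-injective : ∀ {κ e e′ es} → (∀ {x y} → (x , y) ∈ es → (y , x) ∉ es) →
      Incident κ e → Incident κ e′ → e ∈ es → e′ ∈ es → other κ e ≡ other κ e′ → e ≡ e′
    other-injective {κ} {x , y} {x′ , y′} asym inc inc′ e∈ e′∈ eq with x ≟ᴷ κ | x′ ≟ᴷ κ | inc | inc′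
    ... | yes refl | yes refl | _         | _         = cong (x ,_) eq
    ... | yes refl | no  x′≢κ | _         | inj₁ x′≡κ = contradiction x′≡κ x′≢κ
    ... | yes refl | no  _    | _         | inj₂ refl rewrite eq = contradiction e′∈ (asym e∈)
    ... | no  x≢κ  | yes _    | inj₁ x≡κ  | _         = contradiction x≡κ x≢κ
    ... | no  _    | yes refl | inj₂ refl | _ rewrite eq = contradiction e∈ (asym e′∈)
    ... | no  x≢κ  | no  _    | inj₁ x≡κ  | _         = contradiction x≡κ x≢κ
    ... | no  _    | no  x′≢κ | _         | inj₁ x′≡κ = contradiction x′≡κ x′≢κ
    ... | no  _    | no  _    | inj₂ refl | inj₂ refl = cong (_, y) eq

  -- Deleting a vertex of degree at most `d` costs at most `d` edges, so the strict inequality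
  -- between `d` times the vertices and the edges persists. Hence edges remain when no such vertex
  -- is left.
  dense⇒core : ∀ d (ks : List K) (es : List (K × K)) → Unique es →
    (∀ {x y} → (x , y) ∈ es → (y , x) ∉ es) →
    (∀ {x y} → (x , y) ∈ es → x ∈ ks × y ∈ ks) →
    d * length ks < length es → Core d es
  dense⇒core d ks = go (length ks) ks ≤-refl
    where
    -- `fuel` bounds the number of vertices left, which drops with every deletion; at `zero` there
    -- is none to delete.
    go : ∀ fuel (ks : List K) → length ks ≤ fuel → (es : List (K × K)) → Unique es →
      (∀ {x y} → (x , y) ∈ es → (y , x) ∉ es) →
      (∀ {x y} → (x , y) ∈ es → x ∈ ks × y ∈ ks) →
      d * length ks < length es → Core d es
    go fuel ks ks≤fuel es uniq asym ends dense
      with Any.any? (λ κ → length (filter (incident? κ) es) ≤? d) ks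
    ... | no all-large = record
      { core = es
      ; core⊆ = λ p → p
      ; nonempty = some es (≤-<-trans z≤n dense)
      ; neighbours = λ {x} joined →
          map (other x) (filter (incident? x) es)
        , Unique-map-on (other x) _
            (λ p q → let p₁ , p₂ = ∈-filter⁻ (incident? x) {xs = es} p
                         q₁ , q₂ = ∈-filter⁻ (incident? x) {xs = es} q in
              other-injective asym p₂ q₂ p₁ q₁)
            (filter⁺ (incident? x) uniq)
        , subst (d <_) (sym (length-map (other x) (filter (incident? x) es))) (≰⇒> λ small → all-large (Any.map (λ { refl → small }) (key joined)))
        , λ w∈ → let e , e∈ , eq = ∈-map⁻ (other x) w∈
                     e∈es , inc = ∈-filter⁻ (incident? x) {xs = es} e∈ in
            subst (Joined es x) (sym eq) (other-joined inc e∈es)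
      }
      where
      key : ∀ {x y} → Joined es x y → x ∈ ks
      key (inj₁ p) = proj₁ (ends p)
      key (inj₂ p) = proj₂ (ends p)
      some : ∀ (es : List (K × K)) → 0 < length es → ∃ (_∈ es)
      some (e ∷ _) _ = e , here refl
    go zero [] _ es uniq asym ends dense | yes ()
    go (suc fuel) ks ks≤fuel es uniq asym ends dense | yes found
      with κ , κ∈ks , small ← find found = widen (go fuel ks₁ (≤-pred (≤-trans ks₁<ks ks≤fuel)) es₁
        (filter⁺ (¬? ∘ incident? κ) uniq)
        (λ p q → asym (proj₁ (∈-es₁ p)) (proj₁ (∈-es₁ q)))
        (λ p → let q , ¬inc = ∈-es₁ p ; x∈ , y∈ = ends q in
          ∈-filter⁺ ≢κ x∈ (¬inc ∘ inj₁) , ∈-filter⁺ ≢κ y∈ (¬inc ∘ inj₂))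
        dense₁)
      where
      ≢κ : Decidable (_≢ κ)
      ≢κ x = ¬? (x ≟ᴷ κ)
      ks₁ = filter ≢κ ks
      es₁ = filter (¬? ∘ incident? κ) es
      ∈-es₁ : ∀ {e} → e ∈ es₁ → e ∈ es × ¬ Incident κ e
      ∈-es₁ = ∈-filter⁻ (¬? ∘ incident? κ) {xs = es}
      ks₁<ks : length ks₁ < length ks
      ks₁<ks = filter-notAll ≢κ ks (Any.map (λ eq ¬eq → ¬eq (sym eq)) κ∈ks)
      dense₁ : d * length ks₁ < length es₁
      dense₁ = +-cancelˡ-< d _ _ (begin-strict
        d + d * length ks₁     ≡⟨ *-suc d (length ks₁) ⟨
        d * suc (length ks₁)   ≤⟨ *-monoʳ-≤ d ks₁<ks ⟩
        d * length ks          <⟨ dense ⟩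
        length es              ≡⟨ length-filter-split (incident? κ) es ⟩
        length (filter (incident? κ) es) + length es₁ ≤⟨ +-monoˡ-≤ _ small ⟩
        d + length es₁         ∎)
        where open ≤-Reasoning
      widen : Core d es₁ → Core d es
      widen c = record
        { core = Core.core c ; core⊆ = proj₁ ∘ ∈-es₁ ∘ Core.core⊆ c
        ; nonempty = Core.nonempty c ; neighbours = Core.neighbours c }

-- Averaging over two-colourings

-- The sum over all colourings, that is 2ᵐ times the mean.
average : ∀ m → (Vec Bool m → ℕ) → ℕ
average zero    f = f []
average (suc m) f = average m (f ∘ (true ∷_)) + average m (f ∘ (false ∷_))

average-cong : ∀ m {f g : Vec Bool m → ℕ} → (∀ φ → f φ ≡ g φ) → average m f ≡ average m g
average-cong zero    p = p []
average-cong (suc m) p = cong₂ _+_ (average-cong m (p ∘ (true ∷_))) (average-cong m (p ∘ (false ∷_)))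

average-+ : ∀ m (f g : Vec Bool m → ℕ) → average m (λ φ → f φ + g φ) ≡ average m f + average m g
average-+ zero    f g = refl
average-+ (suc m) f g = trans
  (cong₂ _+_ (average-+ m (f ∘ (true ∷_)) _) (average-+ m (f ∘ (false ∷_)) _))
  (interchange (average m (f ∘ (true ∷_))) _ _ _)
  where
  interchange : ∀ a b c d → a + b + (c + d) ≡ a + c + (b + d)
  interchange = solve-∀

average-0 : ∀ m → average m (λ _ → 0) ≡ 0
average-0 zero    = refl
average-0 (suc m) = cong₂ _+_ (average-0 m) (average-0 m)

average-1 : ∀ m → average m (λ _ → 1) ≡ 2 ^ m
average-1 zero    = refl
average-1 (suc m) = cong₂ _+_ (average-1 m) (trans (average-1 m) (sym (+-identityʳ _)))

average-attained : ∀ m (f : Vec Bool m → ℕ) → ∃ λ φ → average m f ≤ 2 ^ m * f φ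
average-attained zero    f = [] , ≤-reflexive (sym (+-identityʳ _))
average-attained (suc m) f with average-attained m (f ∘ (true ∷_)) | average-attained m (f ∘ (false ∷_))
... | φ , p | ψ , q with ≤-total (f (true ∷ φ)) (f (false ∷ ψ))
...   | inj₁ le = false ∷ ψ , ≤-trans (+-mono-≤ (≤-trans p (*-monoʳ-≤ (2 ^ m) le)) q) (≤-reflexive (double (2 ^ m) _))
  where
  double : ∀ a b → a * b + a * b ≡ 2 * a * b
  double = solve-∀
...   | inj₂ le = true ∷ φ , ≤-trans (+-mono-≤ p (≤-trans q (*-monoʳ-≤ (2 ^ m) le))) (≤-reflexive (double (2 ^ m) _))
  where
  double : ∀ a b → a * b + a * b ≡ 2 * a * b
  double = solve-∀

-- Coordinate `i` is a fair coin that `g` does not see, so requiring the value `b` there halves the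
-- mean.
average-literal : ∀ {m} (i : Fin m) b (g : Vec Bool m → ℕ) → (∀ φ c → g (φ [ i ]≔ c) ≡ g φ) →
  average m g ≡ 2 * average m (λ φ → ⟦ lookup φ i Bool.≟ b ⟧ * g φ)
average-literal {suc m} zero true g indep = begin
  average m (g ∘ (true ∷_)) + average m (g ∘ (false ∷_))
    ≡⟨ cong (average m (g ∘ (true ∷_)) +_) (average-cong m λ φ → sym (indep (true ∷ φ) false)) ⟨
  average m (g ∘ (true ∷_)) + average m (g ∘ (true ∷_))
    ≡⟨ cong (average m (g ∘ (true ∷_)) +_) (+-identityʳ _) ⟨
  2 * average m (g ∘ (true ∷_))
    ≡⟨ cong (2 *_) (trans (+-identityʳ _) (average-cong m λ φ → +-identityʳ _)) ⟨
  2 * (average m (λ φ → g (true ∷ φ) + 0) + 0)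
    ≡⟨ cong (λ z → 2 * (average m (λ φ → g (true ∷ φ) + 0) + z)) (average-0 m) ⟨
  2 * (average m (λ φ → g (true ∷ φ) + 0) + average m (λ _ → 0)) ∎
  where open ≡-Reasoning
average-literal {suc m} zero false g indep = begin
  average m (g ∘ (true ∷_)) + average m (g ∘ (false ∷_))
    ≡⟨ cong (_+ average m (g ∘ (false ∷_))) (average-cong m λ φ → indep (false ∷ φ) true) ⟩
  average m (g ∘ (false ∷_)) + average m (g ∘ (false ∷_))
    ≡⟨ cong (average m (g ∘ (false ∷_)) +_) (+-identityʳ _) ⟨
  2 * average m (g ∘ (false ∷_))
    ≡⟨ cong (2 *_) (average-cong m λ φ → +-identityʳ _) ⟨
  2 * average m (λ φ → g (false ∷ φ) + 0)
    ≡⟨ cong (λ z → 2 * (z + average m (λ φ → g (false ∷ φ) + 0))) (average-0 m) ⟨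
  2 * (average m (λ _ → 0) + average m (λ φ → g (false ∷ φ) + 0)) ∎
  where open ≡-Reasoning
average-literal {suc m} (suc i) b g indep = trans
  (cong₂ _+_ (average-literal i b (g ∘ (true ∷_)) (λ φ c → indep (true ∷ φ) c))
             (average-literal i b (g ∘ (false ∷_)) (λ φ c → indep (false ∷ φ) c)))
  (sym (*-distribˡ-+ 2 (average m (λ φ → ⟦ lookup φ i Bool.≟ b ⟧ * g (true ∷ φ))) _))

-- For vertices, `k` is the apex and `i`, `j` are the ends of the pair; for colours, `k` belongs to
-- the pair itself and `i`, `j` to the two sides at the apex.
Separates : ∀ {m} → Vec Bool m → Fin m → Fin m → Fin m → Set
Separates φ i j k = lookup φ i ≡ true × lookup φ j ≡ true × lookup φ k ≡ false

separates? : ∀ {m} (φ : Vec Bool m) i j k → Dec (Separates φ i j k)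
separates? φ i j k = (lookup φ i Bool.≟ true) ×-dec (lookup φ j Bool.≟ true) ×-dec (lookup φ k Bool.≟ false)

-- The coordinates are distinct, so `average-literal` peels off one condition at a time, each with a
-- factor 2.
average-separates : ∀ {m} {i j k : Fin m} → i ≢ j → i ≢ k → j ≢ k →
  2 ^ m ≡ 8 * average m (λ φ → ⟦ separates? φ i j k ⟧)
average-separates {m} {i} {j} {k} i≢j i≢k j≢k = begin
  2 ^ m                          ≡⟨ average-1 m ⟨
  average m (λ _ → 1)            ≡⟨ average-literal k false (λ _ → 1) (λ _ _ → refl) ⟩
  2 * average m f₁               ≡⟨ cong (2 *_) (average-literal j true f₁ (λ φ c → cong (λ b → ⟦ b Bool.≟ false ⟧ * 1) (VecProperties.lookup∘update′ (j≢k ∘ sym) φ c))) ⟩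
  2 * (2 * average m f₂)         ≡⟨ cong (λ z → 2 * (2 * z)) (average-literal i true f₂ (λ φ c → cong₂ (λ a b → ⟦ a Bool.≟ true ⟧ * (⟦ b Bool.≟ false ⟧ * 1)) (VecProperties.lookup∘update′ (i≢j ∘ sym) φ c) (VecProperties.lookup∘update′ (i≢k ∘ sym) φ c))) ⟩
  2 * (2 * (2 * average m f₃))   ≡⟨ eight (average m f₃) ⟩
  8 * average m f₃               ≡⟨ cong (8 *_) (average-cong m merge) ⟩
  8 * average m (λ φ → ⟦ separates? φ i j k ⟧) ∎
  where
  open ≡-Reasoning
  f₁ f₂ f₃ : Vec Bool m → ℕ
  f₁ φ = ⟦ lookup φ k Bool.≟ false ⟧ * 1
  f₂ φ = ⟦ lookup φ j Bool.≟ true ⟧ * f₁ φ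
  f₃ φ = ⟦ lookup φ i Bool.≟ true ⟧ * f₂ φ
  eight : ∀ a → 2 * (2 * (2 * a)) ≡ 8 * a
  eight = solve-∀
  merge : ∀ φ → f₃ φ ≡ ⟦ separates? φ i j k ⟧
  merge φ with lookup φ i | lookup φ j | lookup φ k
  ... | true  | true  | true  = refl
  ... | true  | true  | false = refl
  ... | true  | false | true  = refl
  ... | true  | false | false = refl
  ... | false | _     | _     = refl

module _ {X : Set} {m : ℕ} (i j k : X → Fin m) where

  private
    sep : Vec Bool m → List X → List X
    sep φ = filter (λ x → separates? φ (i x) (j x) (k x))

  -- By linearity, the mean number of separated members is an eighth of `length xs`; some colouring
  -- does at least as well as the mean.
  separating-subfamily : (xs : List X) → (∀ {x} → x ∈ xs → i x ≢ j x × i x ≢ k x × j x ≢ k x) →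
    ∃ λ φ → length xs ≤ 8 * length (filter (λ x → separates? φ (i x) (j x) (k x)) xs)
  separating-subfamily xs distinct
    with φ , bound ← average-attained m (λ φ → length (sep φ xs)) =
    φ , *-cancelˡ-≤ (2 ^ m) {{m^n≢0 2 m}} (begin
      2 ^ m * length xs                              ≡⟨ total xs distinct ⟩
      8 * average m (λ φ → length (sep φ xs))        ≤⟨ *-monoʳ-≤ 8 bound ⟩
      8 * (2 ^ m * length (sep φ xs))                ≡⟨ swap′ 8 (2 ^ m) _ ⟩
      2 ^ m * (8 * length (sep φ xs))                ∎)
    where
    open ≤-Reasoning
    swap′ : ∀ a b c → a * (b * c) ≡ b * (a * c)
    swap′ = solve-∀
    total : (xs : List X) → (∀ {x} → x ∈ xs → i x ≢ j x × i x ≢ k x × j x ≢ k x) →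
      2 ^ m * length xs ≡ 8 * average m (λ φ → length (sep φ xs))
    total []       _        = trans (*-zeroʳ (2 ^ m)) (sym (trans (cong (8 *_) (average-0 m)) (*-zeroʳ 8)))
    total (x ∷ xs) distinct = begin-equality
      2 ^ m * suc (length xs)
        ≡⟨ *-suc (2 ^ m) _ ⟩
      2 ^ m + 2 ^ m * length xs
        ≡⟨ cong₂ _+_ (let p , q , r = distinct (here refl) in average-separates p q r) (total xs (distinct ∘ there)) ⟩
      8 * average m s₁ + 8 * average m s₂
        ≡⟨ *-distribˡ-+ 8 (average m s₁) _ ⟨
      8 * (average m s₁ + average m s₂)
        ≡⟨ cong (8 *_) (trans (sym (average-+ m s₁ s₂)) (average-cong m λ φ → sym (length-filter-∷ (λ x → separates? φ (i x) (j x) (k x)) x xs))) ⟩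
      8 * average m (λ φ → length (sep φ (x ∷ xs))) ∎
      where
      s₁ s₂ : Vec Bool m → ℕ
      s₁ φ = ⟦ separates? φ (i x) (j x) (k x) ⟧
      s₂ φ = length (sep φ xs)

-- Closed walks as cycles

module _ {A : Set} {V : Set} (f : V → V → A) where

  lookup-steps : ∀ {m} s (ys : Vec V m) t i → lookup (steps f s ys t) i ≡ f (lookup (s ∷ ys) i) (lookup (ys ∷ʳ t) i)
  lookup-steps s []       t zero    = refl
  lookup-steps s (y ∷ ys) t zero    = refl
  lookup-steps s (y ∷ ys) t (suc i) = lookup-steps y ys t i

lookup-∷ʳ-inject₁ : ∀ {V : Set} {m} (ys : Vec V m) t i → lookup (ys ∷ʳ t) (inject₁ i) ≡ lookup ys i
lookup-∷ʳ-inject₁ (y ∷ ys) t zero    = refl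
lookup-∷ʳ-inject₁ (y ∷ ys) t (suc i) = lookup-∷ʳ-inject₁ ys t i

lookup-∷ʳ-fromℕ : ∀ {V : Set} {m} (ys : Vec V m) t → lookup (ys ∷ʳ t) (fromℕ m) ≡ t
lookup-∷ʳ-fromℕ []       t = refl
lookup-∷ʳ-fromℕ (y ∷ ys) t = lookup-∷ʳ-fromℕ ys t

next-fromℕ : ∀ m → next (fromℕ m) ≡ zero
next-fromℕ m = Fin.toℕ-injective (trans (Fin.toℕ-fromℕ< _)
  (trans (cong (λ z → suc z % suc m) (Fin.toℕ-fromℕ m)) (n%n≡0 (suc m))))

next-inject₁ : ∀ {m} (i : Fin m) → next (inject₁ i) ≡ suc i
next-inject₁ {m} i = Fin.toℕ-injective (trans (Fin.toℕ-fromℕ< _)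
  (trans (cong (λ z → suc z % suc m) (Fin.toℕ-inject₁ i)) (m<n⇒m%n≡m (s≤s (Fin.toℕ<n i)))))

-- Step `i` ends where the next one starts; the last one wraps round to `s`, as `next` does.
lookup-∷ʳ-next : ∀ {V : Set} {m} s (ys : Vec V m) i → lookup (ys ∷ʳ s) i ≡ lookup (s ∷ ys) (next i)
lookup-∷ʳ-next {m = m} s ys i with view i
... | ‵fromℕ     rewrite next-fromℕ m  = lookup-∷ʳ-fromℕ ys s
... | ‵inject₁ i rewrite next-inject₁ i = lookup-∷ʳ-inject₁ ys s i

-- The index of `RainbowCycle` is one less than its number of vertices, which here are `s` and the
-- `m` entries of `ys`.
closedWalk⇒rainbowCycle : ∀ {n m} (G : Graph n) (χ : ProperEdgeColoring G) s (ys : Vec (Fin n) m) →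
  VecAll.All (_≡ true) (steps (adj G) s ys s) → UniqueVec (s ∷ ys) → UniqueVec (steps (col χ) s ys s) →
  RainbowCycle G χ m
closedWalk⇒rainbowCycle G χ s ys adjacent distinct colours = record
  { vtx     = lookup (s ∷ ys)
  ; vtx-inj = UniqueVec.lookup-injective distinct
  ; edges   = λ i → trans (sym (step (adj G) i)) (lookup⁺ adjacent i)
  ; rainbow = λ i j eq → UniqueVec.lookup-injective colours i j (trans (step (col χ) i) (trans eq (sym (step (col χ) j))))
  }
  where
  step : ∀ {A : Set} (f : Fin _ → Fin _ → A) i →
    lookup (steps f s ys s) i ≡ f (lookup (s ∷ ys) i) (lookup (s ∷ ys) (next i))
  step f i = trans (lookup-steps f s ys s i) (cong (f (lookup (s ∷ ys) i)) (lookup-∷ʳ-next s ys i))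

steps-All : ∀ {V A B : Set} {m} {P : A → Set} {Q : B → Set} {f : V → V → A} {g : V → V → B} →
  (∀ x y → P (f x y) → Q (g x y)) → ∀ s (ys : Vec V m) t →
  VecAll.All P (steps f s ys t) → VecAll.All Q (steps g s ys t)
steps-All P⇒Q s []       t (p VecAll.∷ _)  = P⇒Q s t p VecAll.∷ VecAll.[]
steps-All P⇒Q s (y ∷ ys) t (p VecAll.∷ ps) = P⇒Q s y p VecAll.∷ steps-All P⇒Q y ys t ps

steps-map : ∀ {V A B : Set} {m} {f : V → V → A} {g : V → V → B} (h : A → B) →
  (∀ x y → h (f x y) ≡ g x y) → ∀ s (ys : Vec V m) t → Vec.map h (steps f s ys t) ≡ steps g s ys t
steps-map h eq s []       t = cong (_∷ []) (eq s t)
steps-map h eq s (y ∷ ys) t = cong₂ _∷_ (eq s y) (steps-map h eq y ys t)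

-- Boolean tests, and nested sums as lengths of filtered lists

∧-true : ∀ {a b} → a ∧ b ≡ true → a ≡ true × b ≡ true
∧-true {true} eq = refl , eq

<ᵇ-true : ∀ {a b} → (a <ᵇ b) ≡ true → a < b
<ᵇ-true {a} {b} eq = <ᵇ⇒< a b (Equivalence.from T-≡ eq)

does-true : ∀ {P : Set} (P? : Dec P) → does P? ≡ true → P
does-true (yes p) _ = p

module _ {A : Set} (f : A → Bool) where
  sum-indicator : ∀ xs → sum (map (λ x → if f x then 1 else 0) xs) ≡ length (filter (λ x → f x Bool.≟ true) xs)
  sum-indicator []       = refl
  sum-indicator (x ∷ xs) with f x
  ... | true  = cong suc (sum-indicator xs)
  ... | false = sum-indicator xs

length-filter-map : ∀ {A B : Set} (g : A → B) {P : B → Set} (P? : Decidable P) xs →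
  length (filter P? (map g xs)) ≡ length (filter (P? ∘ g) xs)
length-filter-map g P? []       = refl
length-filter-map g P? (x ∷ xs) with does (P? (g x))
... | true  = cong suc (length-filter-map g P? xs)
... | false = length-filter-map g P? xs

length-filter-× : ∀ {A B : Set} {P : A × B → Set} (P? : Decidable P) xs ys →
  length (filter P? (cartesianProduct xs ys)) ≡ sum (map (λ x → length (filter (λ y → P? (x , y)) ys)) xs)
length-filter-× P? []       ys = refl
length-filter-× P? (x ∷ xs) ys = begin
  length (filter P? (map (x ,_) ys ++ cartesianProduct xs ys))
    ≡⟨ cong length (filter-++ P? (map (x ,_) ys) _) ⟩
  length (filter P? (map (x ,_) ys) ++ filter P? (cartesianProduct xs ys))
    ≡⟨ length-++ (filter P? (map (x ,_) ys)) ⟩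
  length (filter P? (map (x ,_) ys)) + length (filter P? (cartesianProduct xs ys))
    ≡⟨ cong₂ _+_ (length-filter-map (x ,_) P? ys) (length-filter-× P? xs ys) ⟩
  length (filter (λ y → P? (x , y)) ys) + sum (map (λ x → length (filter (λ y → P? (x , y)) ys)) xs) ∎
  where open ≡-Reasoning

sum-map-cong : ∀ {A : Set} {f g : A → ℕ} → (∀ x → f x ≡ g x) → ∀ xs → sum (map f xs) ≡ sum (map g xs)
sum-map-cong p []       = refl
sum-map-cong p (x ∷ xs) = cong₂ _+_ (p x) (sum-map-cong p xs)

-- Graphs given by a list of edges

module _ {n L j : ℕ} (ℓ : Fin n → Fin n → Fin L) (F : List (Fin n × Fin n))
  (F-ordered : ∀ {x y} → (x , y) ∈ F → toℕ x < toℕ y)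
  (ℓ-sym : ∀ {x y} → Joined Fin._≟_ F x y → ℓ x y ≡ ℓ y x)
  (ℓ-proper : ∀ {x y z} → Joined Fin._≟_ F x y → Joined Fin._≟_ F x z → ℓ x y ≡ ℓ x z → y ≡ z)
  (noRainbow : (A : Fin n → Fin n → Bool) → (∀ x y → A x y ≡ true → Joined Fin._≟_ F x y) →
    ∀ s (ys : Vec (Fin n) (suc (suc j + suc j))) → VecAll.All (_≡ true) (steps A s ys s) →
    UniqueVec (s ∷ ys) → UniqueVec (steps ℓ s ys s) → ⊥)
  where

  -- The core becomes a Boolean adjacency matrix `A` whose non-isolated vertices have degree at
  -- least `suc d`. As it is a subgraph of `F`, `noRainbow` covers every `A` inside `F`.
  core-bound : ∀ {d} → Core Fin._≟_ d F →
    suc d ^ (2 + j) ≤ (32 * ((2 + (suc j + suc j)) * (2 + (suc j + suc j)))) ^ (2 + j) * n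
  core-bound {d} C = let (a , b) , e∈ = nonempty in
    minDegree-bound A ℓ A-sym A-irrefl (λ x y Axy → ℓ-sym (A⇒joined x y Axy))
      (λ x y z Axy Axz → ℓ-proper (A⇒joined x y Axy) (A⇒joined x z Axz))
      (noRainbow A A⇒joined) (suc d) minDegree a b (dec-true (joined? a b) (inj₁ e∈))
    where
    open Core C
    open DecMembership (≡-dec (Fin._≟_ {n}) (Fin._≟_ {n})) using (_∈?_)
    joined? : ∀ x y → Dec (Joined Fin._≟_ core x y)
    joined? x y = ((x , y) ∈? core) ⊎-dec ((y , x) ∈? core)
    A : Fin n → Fin n → Bool
    A x y = does (joined? x y)
    A⇒joined : ∀ x y → A x y ≡ true → Joined Fin._≟_ F x y
    A⇒joined x y Axy with does-true (joined? x y) Axy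
    ... | inj₁ p = inj₁ (core⊆ p)
    ... | inj₂ p = inj₂ (core⊆ p)
    A-sym : ∀ x y → A x y ≡ A y x
    A-sym x y = does-⇔ (mk⇔ ⊎-swap ⊎-swap) (joined? x y) (joined? y x)
    A-irrefl : ∀ x → A x x ≡ false
    A-irrefl x = dec-false (joined? x x) (λ
      { (inj₁ p) → <-irrefl refl (F-ordered (core⊆ p))
      ; (inj₂ p) → <-irrefl refl (F-ordered (core⊆ p)) })
    minDegree : ∀ x y → A x y ≡ true → suc d ≤ degree A y
    minDegree x y Axy with ws , uniq , large , good ← neighbours (⊎-swap (does-true (joined? x y) Axy)) =
      ≤-trans large (length≤∑bit (A y) ws uniq (All.tabulate λ {w} w∈ → dec-true (joined? y w) (good w∈)))

  denseGraph-bound : Unique F → ∀ d → d * n < length F →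
    suc d ^ (2 + j) ≤ (32 * ((2 + (suc j + suc j)) * (2 + (suc j + suc j)))) ^ (2 + j) * n
  denseGraph-bound uniq d dense = core-bound (dense⇒core Fin._≟_ d (allFin n) F uniq
    (λ p q → <-asym (F-ordered p) (F-ordered q))
    (λ _ → ∈-allFin _ , ∈-allFin _)
    (subst (λ m → d * m < length F) (sym (length-tabulate {n = n} id)) dense))

-- Properly edge-coloured graphs

module _ {n : ℕ} (G : Graph n) (χ : ProperEdgeColoring G) where

  private
    V : Set
    V = Fin n

  edge-sym : ∀ {x y} → Edge G x y → Edge G y x
  edge-sym {x} {y} e = trans (adj-sym G y x) e

  edge⇒≢ : ∀ {x y} → Edge G x y → x ≢ y
  edge⇒≢ {x} e refl with () ← trans (sym (irrefl G x)) e

  col-injective : ∀ {x y z} → Edge G x y → Edge G x z → col χ x y ≡ col χ x z → y ≡ z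
  col-injective {x} {y} {z} e f eq with y Fin.≟ z
  ... | yes p = p
  ... | no ¬p = contradiction eq (proper χ x y z e f ¬p)

  -- Rainbow paths in a link of large minimum degree

  -- `P` is the vertex set of a subgraph of the link of `v` with minimum degree above `K`.
  module Link (v : V) (P : V → Set) (K : ℕ) (P⇒edge : ∀ {x} → P x → Edge G v x)
    (neighbours : ∀ {x} → P x → ∃ λ ws → Unique ws × K < length ws × (∀ {w} → w ∈ ws → P w × Edge G x w)) where

    -- The path is stored from its growing end `head` and runs through `tail` on to `v`, with
    -- `suc i` edges including the last one into `v`.
    record LinkPath (i : ℕ) : Set where
      field
        head     : V
        tail     : Vec V i
        P-head   : P head
        adjacent : VecAll.All (_≡ true) (steps (adj G) head tail v)
        distinct : UniqueVec (head ∷ tail)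
        avoids-v : VecAll.All (v ≢_) (head ∷ tail)
        colours  : UniqueVec (steps (col χ) head tail v)

    open LinkPath

    -- Each forbidden vertex excludes one neighbour, and by properness each forbidden colour
    -- excludes at most one at `x` and at most one at `v`: at most `3 * m` in all.
    choose : ∀ {m} x (zs : Vec V m) (cs : Vec ℕ m) → P x → 3 * m ≤ K →
      ∃ λ w → P w × Edge G x w × VecAll.All (w ≢_) zs × VecAll.All (col χ x w ≢_) cs × VecAll.All (col χ v w ≢_) cs
    choose {m} x zs cs Px bound
      with ws , uniq , K<ws , good ← neighbours Px
      with ws₁ , uniq₁ , sub₁ , len₁ ← avoid Fin._≟_ id zs ws uniq (λ _ _ → id)
      with ws₂ , uniq₂ , sub₂ , len₂ ← avoid _≟_ (col χ x) cs ws₁ uniq₁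
             (λ a b → col-injective (proj₂ (good (proj₁ (sub₁ a)))) (proj₂ (good (proj₁ (sub₁ b)))))
      with avoid _≟_ (col χ v) cs ws₂ uniq₂
             (λ a b → col-injective (P⇒edge (proj₁ (good (proj₁ (sub₁ (proj₁ (sub₂ a)))))))
                                    (P⇒edge (proj₁ (good (proj₁ (sub₁ (proj₁ (sub₂ b))))))))
    ... | [] , _ , _ , len₃ = contradiction K<ws (≤⇒≯ (begin
        length ws                     ≤⟨ len₁ ⟩
        m + length ws₁                ≤⟨ +-monoʳ-≤ m len₂ ⟩
        m + (m + length ws₂)          ≤⟨ +-monoʳ-≤ m (+-monoʳ-≤ m len₃) ⟩
        3 * m                         ≤⟨ bound ⟩
        K                             ∎))
        where open ≤-Reasoning
    ... | w ∷ _ , _ , sub₃ , _ =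
      let w∈ws₂ , v-colours = sub₃ (here refl)
          w∈ws₁ , x-colours = sub₂ w∈ws₂
          w∈ws  , vertices  = sub₁ w∈ws₁
          Pw    , xw        = good w∈ws
      in w , Pw , xw , vertices , x-colours , v-colours

    -- The new head is chosen so that the colour of its edge to `v` is also absent from the old
    -- path; it differs from the colour of the new path edge by properness. So the path can be
    -- closed up through `v`.
    extend : ∀ {i} → 3 * suc i ≤ K → LinkPath i →
      ∃ λ (p : LinkPath (suc i)) → VecAll.All (col χ v (head p) ≢_) (steps (col χ) (head p) (tail p) v)
    extend {i} bound p =
      let w , Pw , xw , vertices , x-colours , v-colours =
            choose (head p) (head p ∷ tail p) (steps (col χ) (head p) (tail p) v) (P-head p) bound
      in record
        { head = w
        ; tail = head p ∷ tail p
        ; P-head = Pw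
        ; adjacent = edge-sym xw VecAll.∷ adjacent p
        ; distinct = vertices ∷ distinct p
        ; avoids-v = edge⇒≢ (P⇒edge Pw) VecAll.∷ avoids-v p
        ; colours = subst (λ c → VecAll.All (c ≢_) (steps (col χ) (head p) (tail p) v)) (col-sym χ (head p) w xw) x-colours ∷ colours p
        } , (λ eq → proper χ w v (head p) (edge-sym (P⇒edge Pw)) (edge-sym xw) (edge⇒≢ (P⇒edge (P-head p)))
               (trans (col-sym χ w v (edge-sym (P⇒edge Pw))) eq)) VecAll.∷ v-colours

    linkPath : ∀ i → 3 * i ≤ K → ∃ P → LinkPath i
    linkPath zero    _     (x , Px) = record
      { head = x ; tail = [] ; P-head = Px
      ; adjacent = edge-sym (P⇒edge Px) VecAll.∷ VecAll.[]
      ; distinct = VecAll.[] ∷ []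
      ; avoids-v = edge⇒≢ (P⇒edge Px) VecAll.∷ VecAll.[]
      ; colours = VecAll.[] ∷ [] }
    linkPath (suc i) bound start = proj₁ (extend bound (linkPath i (≤-trans (*-monoʳ-≤ 3 (n≤1+n i)) bound) start))

    -- `linkPath i` has `suc i` vertices besides `v`, and the extension adds one more. Together with
    -- `v` these are `3 + i` vertices, hence the index `2 + i`.
    link⇒rainbowCycle : ∀ i → 3 * suc i ≤ K → ∃ P → RainbowCycle G χ (2 + i)
    link⇒rainbowCycle i bound start =
      let p , last-colour = extend bound (linkPath i (≤-trans (*-monoʳ-≤ 3 (n≤1+n i)) bound) start) in
      closedWalk⇒rainbowCycle G χ v (head p ∷ tail p)
        (P⇒edge (P-head p) VecAll.∷ adjacent p)
        (avoids-v p ∷ distinct p)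
        (last-colour ∷ colours p)

  -- Triangles and the pairs that they span

  Apexed : V × V → Set
  Apexed (a , b) = toℕ a < toℕ b × Edge G a b × ∃ λ c → Edge G a c × Edge G b c

  apexed? : Decidable Apexed
  apexed? (a , b) = (toℕ a <? toℕ b) ×-dec (adj G a b Bool.≟ true) ×-dec
    Fin.any? (λ c → (adj G a c Bool.≟ true) ×-dec (adj G b c Bool.≟ true))

  apexedPairs : List (V × V)
  apexedPairs = filter apexed? (cartesianProduct (allFin n) (allFin n))

  ∈-apexedPairs : ∀ {e} → Apexed e → e ∈ apexedPairs
  ∈-apexedPairs = ∈-filter⁺ apexed? (∈-cartesianProduct⁺ (∈-allFin _) (∈-allFin _))

  private
    isTriangle? : Decidable (λ ((a , b , c) : V × V × V) → isTriangle G a b c ≡ true)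
    isTriangle? (a , b , c) = isTriangle G a b c Bool.≟ true

  triangleList : List (V × V × V)
  triangleList = filter isTriangle? (cartesianProduct (allFin n) (cartesianProduct (allFin n) (allFin n)))

  triangles≡length : triangles G ≡ length triangleList
  triangles≡length = sym (trans (length-filter-× isTriangle? (allFin n) _)
    (sum-map-cong (λ a → trans (length-filter-× (λ bc → isTriangle? (a , bc)) (allFin n) (allFin n))
      (sum-map-cong (λ b → sym (sum-indicator (isTriangle G a b) (allFin n))) (allFin n))) (allFin n)))

  ∈-triangleList⁻ : ∀ {a b c} → (a , b , c) ∈ triangleList →
    toℕ a < toℕ b × toℕ b < toℕ c × Edge G a b × Edge G b c × Edge G a c
  ∈-triangleList⁻ t∈
    with ab , p ← ∧-true (proj₂ (∈-filter⁻ isTriangle? {xs = cartesianProduct (allFin n) (cartesianProduct (allFin n) (allFin n))} t∈))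
    with bc , q ← ∧-true p
    with eab , r ← ∧-true q
    with ebc , eac ← ∧-true r = <ᵇ-true ab , <ᵇ-true bc , eab , ebc , eac

  private
    -- The pair (a , b) stands for the vertex b of the link of a.
    linkEdge : V × V × V → (V × V) × (V × V)
    linkEdge (a , b , c) = (a , b) , (a , c)

    linkEdge-injective : ∀ {s t} → linkEdge s ≡ linkEdge t → s ≡ t
    linkEdge-injective refl = refl

    linkEdges : List ((V × V) × (V × V))
    linkEdges = map linkEdge triangleList

    ∈-linkEdges⁻ : ∀ {a b a′ c} → ((a , b) , (a′ , c)) ∈ linkEdges →
      a ≡ a′ × toℕ a < toℕ b × toℕ b < toℕ c × Edge G a b × Edge G b c × Edge G a c
    ∈-linkEdges⁻ e∈ with (a , b , c) , t∈ , refl ← ∈-map⁻ linkEdge e∈ = refl , ∈-triangleList⁻ t∈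

  _≟ᴾ_ = ≡-dec (Fin._≟_ {n}) (Fin._≟_ {n})

  -- The links, each restricted to later vertices, form one graph on the apexed pairs with one edge
  -- per triangle. Edges join only pairs with the same first entry, so the part of a core at first
  -- entry `v` lies in the link of `v`.
  triangles≤pairs : ∀ i → ¬ RainbowCycle G χ (2 + i) → triangles G ≤ 3 * (2 + i) * length apexedPairs
  triangles≤pairs i noCycle = subst (_≤ 3 * (2 + i) * length apexedPairs) (sym triangles≡length) (≮⇒≥ λ dense →
    noCycle (core⇒cycle (dense⇒core _≟ᴾ_ (3 * (2 + i)) apexedPairs linkEdges
      (map⁺ linkEdge-injective (filter⁺ isTriangle? (cartesianProduct⁺ (allFin⁺ n) (cartesianProduct⁺ (allFin⁺ n) (allFin⁺ n)))))
      (λ p q → <-asym (proj₁ (proj₂ (proj₂ (∈-linkEdges⁻ p)))) (proj₁ (proj₂ (proj₂ (∈-linkEdges⁻ q)))))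
      endpoints
      (subst (3 * (2 + i) * length apexedPairs <_) (sym (length-map linkEdge triangleList)) dense))))
    where
    endpoints : ∀ {x y} → (x , y) ∈ linkEdges → x ∈ apexedPairs × y ∈ apexedPairs
    endpoints e∈ with refl , a<b , b<c , ab , bc , ac ← ∈-linkEdges⁻ e∈ =
      ∈-apexedPairs (a<b , ab , _ , ac , bc) , ∈-apexedPairs (<-trans a<b b<c , ac , _ , ab , edge-sym bc)
    core⇒cycle : Core _≟ᴾ_ (3 * (2 + i)) linkEdges → RainbowCycle G χ (2 + i)
    core⇒cycle C with ((v , x) , (v′ , y)) , e∈ ← Core.nonempty C =
      Link.link⇒rainbowCycle v P (3 * (2 + i)) P⇒edge neighbours i (*-monoʳ-≤ 3 (n≤1+n (suc i)))
        (x , (v′ , y) , inj₁ e∈)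
      where
      P : V → Set
      P x = ∃ λ e → Joined _≟ᴾ_ (Core.core C) (v , x) e
      joined⇒triangle : ∀ {x u y} → Joined _≟ᴾ_ (Core.core C) (v , x) (u , y) → u ≡ v × Edge G v x × Edge G x y
      joined⇒triangle (inj₁ p) with refl , _ , _ , vx , xy , _ ← ∈-linkEdges⁻ (Core.core⊆ C p) = refl , vx , xy
      joined⇒triangle (inj₂ p) with refl , _ , _ , _ , yx , vx ← ∈-linkEdges⁻ (Core.core⊆ C p) = refl , vx , edge-sym yx
      P⇒edge : ∀ {x} → P x → Edge G v x
      P⇒edge (_ , joined) = proj₁ (proj₂ (joined⇒triangle joined))
      neighbours : ∀ {x} → P x → ∃ λ ws → Unique ws × 3 * (2 + i) < length ws × (∀ {w} → w ∈ ws → P w × Edge G x w)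
      neighbours {x} (_ , joined) with ws , uniq , large , good ← Core.neighbours C joined =
        map proj₂ ws
        , Unique-map-on proj₂ ws (λ p q eq → cong₂ _,_
            (trans (proj₁ (joined⇒triangle (good p))) (sym (proj₁ (joined⇒triangle (good q))))) eq) uniq
        , subst (3 * (2 + i) <_) (sym (length-map proj₂ ws)) large
        , λ w∈ → member w∈
        where
        member : ∀ {w} → w ∈ map proj₂ ws → P w × Edge G x w
        member w∈ with (u , w) , uw∈ , refl ← ∈-map⁻ proj₂ w∈
          with refl , _ , xw ← joined⇒triangle (good uw∈) = ((v , x) , ⊎-swap (good uw∈)) , xw

  -- A subgraph whose rainbow even cycles extend through an apex

  private
    -- This sum is at least every colour, so that finitely many labels suffice and one can sum over
    -- colours.
    palette : ℕ
    palette = ∑ λ x → ∑ λ y → col χ x y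

    ℓ : V → V → Fin (suc palette)
    ℓ x y = fromℕ< (s≤s (≤-trans (term≤∑ (col χ x) y) (term≤∑ (λ x → ∑ (col χ x)) x)))

    toℕ-ℓ : ∀ x y → toℕ (ℓ x y) ≡ col χ x y
    toℕ-ℓ x y = Fin.toℕ-fromℕ< _

    ℓ-sym : ∀ {x y} → Edge G x y → ℓ x y ≡ ℓ y x
    ℓ-sym {x} {y} e = Fin.toℕ-injective (trans (toℕ-ℓ x y) (trans (col-sym χ x y e) (sym (toℕ-ℓ y x))))

    ℓ-injective : ∀ {x y z} → Edge G x y → Edge G x z → ℓ x y ≡ ℓ x z → y ≡ z
    ℓ-injective {x} {y} {z} e f eq = col-injective e f (trans (sym (toℕ-ℓ x y)) (trans (cong toℕ eq) (toℕ-ℓ x z)))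

    opaque
      apex : V × V → V
      apex e with apexed? e
      ... | yes (_ , _ , c , _) = c
      -- A default value: `apex-edges` concerns apexed pairs only.
      ... | no  _               = proj₁ e

      apex-edges : ∀ {a b} → (a , b) ∈ apexedPairs →
        toℕ a < toℕ b × Edge G a b × Edge G a (apex (a , b)) × Edge G b (apex (a , b))
      apex-edges {a} {b} e∈ with apexed? (a , b)
      ... | yes (a<b , ab , c , ac , bc) = a<b , ab , ac , bc
      ... | no ¬apexed = contradiction (proj₂ (∈-filter⁻ apexed? {xs = cartesianProduct (allFin n) (allFin n)} e∈)) ¬apexed

  module Split (φ : Vec Bool n) (ψ : Vec Bool (suc palette)) where

    vertexSplit? : Decidable (λ e → Separates φ (proj₁ e) (proj₂ e) (apex e))
    vertexSplit? e = separates? φ (proj₁ e) (proj₂ e) (apex e)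

    colourSplit? : Decidable (λ e → Separates ψ (ℓ (proj₁ e) (apex e)) (ℓ (proj₂ e) (apex e)) (ℓ (proj₁ e) (proj₂ e)))
    colourSplit? e = separates? ψ (ℓ (proj₁ e) (apex e)) (ℓ (proj₂ e) (apex e)) (ℓ (proj₁ e) (proj₂ e))

    F : List (V × V)
    F = filter colourSplit? (filter vertexSplit? apexedPairs)

    -- An edge of F with its apex w, which φ separates from the vertices of F, just as ψ separates colours.
    record Roofed (x y : V) : Set where
      field
        w        : V
        xy       : Edge G x y
        xw       : Edge G x w
        yw       : Edge G y w
        φ-x      : lookup φ x ≡ true
        φ-w      : lookup φ w ≡ false
        ψ-xw     : lookup ψ (ℓ x w) ≡ true
        ψ-yw     : lookup ψ (ℓ y w) ≡ true
        ψ-xy     : lookup ψ (ℓ x y) ≡ false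

    F⊆pairs : ∀ {e} → e ∈ F → e ∈ apexedPairs
    F⊆pairs e∈ = proj₁ (∈-filter⁻ vertexSplit? {xs = apexedPairs} (proj₁ (∈-filter⁻ colourSplit? {xs = filter vertexSplit? apexedPairs} e∈)))

    roof : ∀ {a b} → (a , b) ∈ F → Roofed a b × Roofed b a
    roof {a} {b} e∈
      with e∈₁ , ψa , ψb , ψab ← ∈-filter⁻ colourSplit? {xs = filter vertexSplit? apexedPairs} e∈
      with e∈₂ , φa , φb , φc ← ∈-filter⁻ vertexSplit? {xs = apexedPairs} e∈₁
      with _ , ab , ac , bc ← apex-edges e∈₂ =
        record { w = apex (a , b) ; xy = ab ; xw = ac ; yw = bc ; φ-x = φa ; φ-w = φc ; ψ-xw = ψa ; ψ-yw = ψb ; ψ-xy = ψab }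
      , record { w = apex (a , b) ; xy = edge-sym ab ; xw = bc ; yw = ac ; φ-x = φb ; φ-w = φc ; ψ-xw = ψb ; ψ-yw = ψa
               ; ψ-xy = trans (cong (lookup ψ) (sym (ℓ-sym ab))) ψab }

    roofed : ∀ {x y} → Joined Fin._≟_ F x y → Roofed x y
    roofed (inj₁ e∈) = proj₁ (roof e∈)
    roofed (inj₂ e∈) = proj₂ (roof e∈)

    module _ {j : ℕ} (noCycle : ¬ RainbowCycle G χ (suc (suc (suc j + suc j)))) where

      -- Replacing the edge `s y` by the detour through its apex `w` makes the cycle one longer. `φ`
      -- tells `w` from all vertices of the cycle, and `ψ` tells the two new colours from those
      -- kept; the new colours differ from each other by properness at `w`.
      no-rainbow-evenCycle : (A : V → V → Bool) → (∀ x y → A x y ≡ true → Roofed x y) →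
        ∀ s (ys : Vec V (suc (suc j + suc j))) → VecAll.All (_≡ true) (steps A s ys s) →
        UniqueVec (s ∷ ys) → UniqueVec (steps ℓ s ys s) → ⊥
      no-rainbow-evenCycle A A⇒roofed s (y ∷ ys) (Asy VecAll.∷ As) ((s≢y VecAll.∷ s≢ys) ∷ y∉ys) (_ ∷ colours) =
        noCycle (closedWalk⇒rainbowCycle G χ s (w ∷ y ∷ ys)
          (xw VecAll.∷ edge-sym yw VecAll.∷ steps-All (λ u v Auv → Roofed.xy (A⇒roofed u v Auv)) y ys s As)
          (((λ s≡w → VecAll.head w≢vertices (sym s≡w)) VecAll.∷ s≢y VecAll.∷ s≢ys) ∷ VecAll.tail w≢vertices ∷ y∉ys)
          (subst UniqueVec (steps-map toℕ toℕ-ℓ s (w ∷ y ∷ ys) s)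
            (UniqueVec.map⁺ Fin.toℕ-injective
              ((sw≢wy VecAll.∷ fresh (ℓ s w) ψ-xw) ∷ fresh (ℓ w y) (trans (cong (lookup ψ) (sym (ℓ-sym yw))) ψ-yw) ∷ colours))))
        where
        open Roofed (A⇒roofed s y Asy)
        w≢vertices : VecAll.All (w ≢_) (s ∷ y ∷ ys)
        w≢vertices = subst (VecAll.All (w ≢_)) (steps-source s (y ∷ ys) s)
          (steps-All {g = λ u _ → u} (λ u v Auv w≡u → contradiction (trans (sym (Roofed.φ-x (A⇒roofed u v Auv))) (trans (cong (lookup φ) (sym w≡u)) φ-w)) λ ()) s (y ∷ ys) s (Asy VecAll.∷ As))
        sw≢wy : ℓ s w ≢ ℓ w y
        sw≢wy eq = s≢y (ℓ-injective (edge-sym xw) (edge-sym yw) (trans (sym (ℓ-sym xw)) eq))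
        fresh : ∀ c → lookup ψ c ≡ true → VecAll.All (c ≢_) (steps ℓ y ys s)
        fresh c ψc = steps-All (λ u v Auv c≡ → contradiction (trans (sym ψc) (trans (cong (lookup ψ) c≡) (Roofed.ψ-xy (A⇒roofed u v Auv)))) λ ()) y ys s As

      sparse : ∀ d → d * n < length F →
        suc d ^ (2 + j) ≤ (32 * ((2 + (suc j + suc j)) * (2 + (suc j + suc j)))) ^ (2 + j) * n
      sparse d dense = denseGraph-bound {j = j} ℓ F
        (λ e∈ → proj₁ (apex-edges (F⊆pairs e∈)))
        (λ xy → ℓ-sym (Roofed.xy (roofed xy)))
        (λ xy xz → ℓ-injective (Roofed.xy (roofed xy)) (Roofed.xy (roofed xz)))
        (λ A A⇒joined → no-rainbow-evenCycle A (λ x y → roofed ∘ A⇒joined x y))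
        (filter⁺ colourSplit? (filter⁺ vertexSplit? (filter⁺ apexed? (cartesianProduct⁺ (allFin⁺ n) (allFin⁺ n)))))
        d dense

  -- The vertex split and then the colour split each cost a factor 8. The three colours of a
  -- triangle are distinct because any two sides share a vertex.
  pairs≤64*F : ∃ λ φ → ∃ λ ψ → length apexedPairs ≤ 64 * length (Split.F φ ψ)
  pairs≤64*F =
    let φ , p = separating-subfamily proj₁ proj₂ apex apexedPairs vertices-distinct
        ψ , q = separating-subfamily (λ e → ℓ (proj₁ e) (apex e)) (λ e → ℓ (proj₂ e) (apex e)) (λ e → ℓ (proj₁ e) (proj₂ e))
          (filter (vertexSplit? φ) apexedPairs)
          (λ e∈ → colours-distinct (proj₁ (∈-filter⁻ (vertexSplit? φ) {xs = apexedPairs} e∈)))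
    in φ , ψ , ≤8*8 {b = length (filter (vertexSplit? φ) apexedPairs)} {length (Split.F φ ψ)} p q
    where
    vertexSplit? : ∀ φ → Decidable (λ e → Separates φ (proj₁ e) (proj₂ e) (apex e))
    vertexSplit? φ e = separates? φ (proj₁ e) (proj₂ e) (apex e)
    vertices-distinct : ∀ {e} → e ∈ apexedPairs → proj₁ e ≢ proj₂ e × proj₁ e ≢ apex e × proj₂ e ≢ apex e
    vertices-distinct e∈ = let _ , ab , ac , bc = apex-edges e∈ in edge⇒≢ ab , edge⇒≢ ac , edge⇒≢ bc
    colours-distinct : ∀ {e} → e ∈ apexedPairs → let a = proj₁ e ; b = proj₂ e ; c = apex e in
      ℓ a c ≢ ℓ b c × ℓ a c ≢ ℓ a b × ℓ b c ≢ ℓ a b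
    colours-distinct e∈ = let _ , ab , ac , bc = apex-edges e∈ in
        (λ eq → edge⇒≢ ab (ℓ-injective (edge-sym ac) (edge-sym bc) (trans (sym (ℓ-sym ac)) (trans eq (ℓ-sym bc)))))
      , (λ eq → edge⇒≢ bc (sym (ℓ-injective ac ab eq)))
      , (λ eq → edge⇒≢ ac (sym (ℓ-injective bc (edge-sym ab) (trans eq (ℓ-sym ab)))))
    ≤8*8 : ∀ {a b c} → a ≤ 8 * b → b ≤ 8 * c → a ≤ 64 * c
    ≤8*8 {c = c} p q = ≤-trans p (≤-trans (*-monoʳ-≤ 8 q) (≤-reflexive (sym (*-assoc 8 8 c))))

-- From sparse graphs to the number of triangles

private
  m<[1+m/n]*n : ∀ m n → m < suc (m / suc n) * suc n
  m<[1+m/n]*n m n = begin-strict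
    m                                       ≡⟨ m≡m%n+[m/n]*n m (suc n) ⟩
    m % suc n + m / suc n * suc n           <⟨ +-monoˡ-< (m / suc n * suc n) (m%n<n m (suc n)) ⟩
    suc (m / suc n) * suc n                 ∎
    where open ≤-Reasoning

-- For `f` positive, let `d` be the largest number with `d * n < f`. Then `f ≤ suc d * n`, and the
-- bound on `suc d` becomes one on `f`.
sparse⇒size-bound : ∀ k C n f → (∀ d → d * n < f → suc d ^ suc k ≤ C ^ suc k * n) → 0 < n →
  f ^ suc k ≤ C ^ suc k * n ^ (suc k + 1)
sparse⇒size-bound k C n       zero    sparse _ = z≤n
sparse⇒size-bound k C (suc n) (suc f) sparse _ = begin
  suc f ^ suc k                                 ≤⟨ ^-monoˡ-≤ (suc k) (m<[1+m/n]*n f n) ⟩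
  (suc (f / suc n) * suc n) ^ suc k             ≡⟨ ^-distribʳ-* (suc k) (suc (f / suc n)) (suc n) ⟩
  suc (f / suc n) ^ suc k * suc n ^ suc k       ≤⟨ *-monoˡ-≤ (suc n ^ suc k) (sparse (f / suc n) (s≤s (m/n*n≤m f (suc n)))) ⟩
  C ^ suc k * suc n * suc n ^ suc k             ≡⟨ *-assoc (C ^ suc k) (suc n) _ ⟩
  C ^ suc k * suc n ^ suc (suc k)               ≡⟨ cong (λ e → C ^ suc k * suc n ^ e) (+-comm 1 (suc k)) ⟩
  C ^ suc k * suc n ^ (suc k + 1)               ∎
  where open ≤-Reasoning

power-bound-trans : ∀ k K A C n {T p f} → T ≤ K * p → p ≤ A * f → f ^ k ≤ C ^ k * n ^ (k + 1) →
  T ^ k ≤ (K * A * C) ^ k * n ^ (k + 1)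
power-bound-trans k K A C n {T} {p} {f} T≤Kp p≤Af fᵏ≤ = begin
  T ^ k                              ≤⟨ ^-monoˡ-≤ k T≤Kp ⟩
  (K * p) ^ k                        ≤⟨ ^-monoˡ-≤ k (*-monoʳ-≤ K p≤Af) ⟩
  (K * (A * f)) ^ k                  ≡⟨ cong (_^ k) (*-assoc K A f) ⟨
  (K * A * f) ^ k                    ≡⟨ ^-distribʳ-* k (K * A) f ⟩
  (K * A) ^ k * f ^ k                ≤⟨ *-monoʳ-≤ ((K * A) ^ k) fᵏ≤ ⟩
  (K * A) ^ k * (C ^ k * n ^ (k + 1)) ≡⟨ *-assoc ((K * A) ^ k) (C ^ k) _ ⟨
  (K * A) ^ k * C ^ k * n ^ (k + 1)  ≡⟨ cong (_* n ^ (k + 1)) (^-distribʳ-* k (K * A) C) ⟨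
  (K * A * C) ^ k * n ^ (k + 1)      ∎
  where open ≤-Reasoning

-- Taking `k`-th powers clears the exponent `1 + 1/k`, and a `RainbowCycle` of index `2 * k` has
-- `2 * k + 1` vertices.
theorem1p2 : (k : ℕ) → 2 ≤ k →
    Σ ℕ (λ c → (n : ℕ) (G : Graph n) (χ : ProperEdgeColoring G) →
    ¬ RainbowCycle G χ (2 * k) →
    triangles G ^ k ≤ c ^ k * n ^ (k + 1))
theorem1p2 (suc zero)    (s≤s ())
-- `K` bounds the triangles per apexed pair, 64 is the loss in the two splits and `C` comes from the
-- trace estimate, with `M` equal to `2 * k`.
theorem1p2 (suc (suc j)) _ = K * 64 * C , bound
  where
  M K C : ℕ
  M = 2 + (suc j + suc j)
  K = 3 * M
  C = 32 * (M * M)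
  2k≡M : ∀ j → 2 * (2 + j) ≡ 2 + (suc j + suc j)
  2k≡M = solve-∀
  bound⁺ : ∀ {n} (G : Graph n) (χ : ProperEdgeColoring G) → ¬ RainbowCycle G χ M → 0 < n →
    triangles G ^ (2 + j) ≤ (K * 64 * C) ^ (2 + j) * n ^ (2 + j + 1)
  bound⁺ {n} G χ noCycle 0<n = let φ , ψ , pairs≤ = pairs≤64*F G χ in
    power-bound-trans (2 + j) K 64 C n {f = length (Split.F G χ φ ψ)} (triangles≤pairs G χ (suc j + suc j) noCycle) pairs≤
      (sparse⇒size-bound (suc j) C n (length (Split.F G χ φ ψ)) (Split.sparse G χ φ ψ {j = j} noCycle) 0<n)
  bound : (n : ℕ) (G : Graph n) (χ : ProperEdgeColoring G) → ¬ RainbowCycle G χ (2 * (2 + j)) →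
    triangles G ^ (2 + j) ≤ (K * 64 * C) ^ (2 + j) * n ^ (2 + j + 1)
  -- Without vertices there are no triangles; the division by `n` in the general case requires `n`
  -- to be positive.
  bound zero    G χ _       = z≤n
  bound (suc _) G χ noCycle = bound⁺ G χ (noCycle ∘ subst (RainbowCycle G χ) (sym (2k≡M j))) (s≤s z≤n)
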